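{- Let $\mathcal{F}$ be a $q$-exponential family with hand enumerator $\mathcal{H}(x,y)$ and deck enumerator $\mathcal{D}(x)$. Then, as formal power series, \[ \mathcal{H}(x,y)=\exp\big(y\,\mathcal{D}(x)\big). \]
   Context: Fix a finite field $\mathbf{F}_q$. Let $\mathbf{F}_q^{(\mathbf{N})}$ be the vector space of infinite sequences over $\mathbf{F}_q$ with finitely many nonzero entries, with standard basis $e_1,e_2,\dots$, and let $E_n=\mathrm{span}(e_1,\dots,e_n)$. Fix an abstract set $P$ of "pictures". A $q$-card $Q(V,p)$ is a pair of a subspace $V\subset\mathbf{F}_q^{(\mathbf{N})}$ (label space) and a picture $p\in P$; its dimension is $\dim V$; it is standard if $V=E_{\dim V}$. A card $Q(V',p)$ is a relabeling of $Q(V,p)$ if $\dim V'=\dim V$. A $q$-deck of dimension $n$ is a finite set of standard cards all of dimension $n$ with pairwise different pictures. A $q$-exponential family $\mathcal{F}$ is a sequence of $q$-decks $\mathcal{D}_1,\mathcal{D}_2,\dots$ with $\mathcal{D}_n$ of dimension $n$ (possibly empty); let $d_n=|\mathcal{D}_n|$. A hand of $\mathcal{F}$ of dimension $n$ is a finite set of cards, each a relabeling of a card in some deck of $\mathcal{F}$, whose label spaces form a direct sum decomposition of $E_n$. Let $\gamma_n=|\mathrm{GL}_n(\mathbf{F}_q)|=\prod_{i=0}^{n-1}(q^n-q^i)$, $\gamma_0=1$. The hand enumerator is $\mathcal{H}(x,y)=\sum_{n,k\ge0}h(n,k)\frac{x^n}{\gamma_n}y^k$, where $h(n,k)$ is the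 number of hands of dimension $n$ with $k$ cards, with $h(0,0)=1$ and $h(n,0)=h(0,k)=0$ for $n,k>0$. The deck enumerator is $\mathcal{D}(x)=\sum_{n\ge1}\frac{d_n}{\gamma_n}x^n$. -}

module Defs where

open import Level using (0ℓ)
open import Data.Nat as ℕ using (ℕ; zero; suc; _∸_; _^_)
open import Data.Nat using (_!)
open import Data.Integer using (+_)
open import Data.Rational using (ℚ; _/_; 0ℚ; 1ℚ) renaming (_+_ to _+ℚ_; _*_ to _*ℚ_)
open import Data.Fin using (Fin)
open import Data.Fin.Permutation using (Permutation′; _⟨$⟩ʳ_)
open import Data.Vec using (Vec; []; _∷_; zipWith; replicate)
import Data.Vec as V
open import Data.List using (List; []; length)
open import Data.List.Membership.Propositional using (_∈_)
open import Data.List.Relation.Unary.Unique.Propositional using (Unique)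
open import Data.Bool using (Bool; true; false)
open import Data.Product using (Σ; _×_; ∃; ∃-syntax)
open import Relation.Binary.PropositionalEquality using (_≡_)
open import Relation.Nullary using (¬_)
open import Relation.Binary.Definitions using (DecidableEquality)
open import Algebra.Structures using (IsCommutativeRing)

record FiniteField : Set₁ where
  infixl 6 _+_
  infixl 7 _*_
  field
    F       : Set
    _+_ _*_ : F → F → F
    -_      : F → F
    0# 1#   : F
    isCommutativeRing : IsCommutativeRing _≡_ _+_ _*_ -_ 0# 1#
    0≢1     : ¬ (0# ≡ 1#)
    inverse : ∀ x → ¬ (x ≡ 0#) → ∃[ y ] (x * y ≡ 1#)
    _≟_     : DecidableEquality F
    elements : List F
    complete : ∀ x → x ∈ elements
    distinct : Unique elements

  q : ℕ
  q = length elements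

-- a / b as a rational (b = 0 never occurs in our uses; we return 0 then)
_//_ : ℕ → ℕ → ℚ
a // zero  = 0ℚ
a // suc b = (+ a) / suc b

sumℚ : ℕ → (ℕ → ℚ) → ℚ
sumℚ zero    f = 0ℚ
sumℚ (suc n) f = sumℚ n f +ℚ f n

prodℕ : ℕ → (ℕ → ℕ) → ℕ
prodℕ zero    f = 1
prodℕ (suc n) f = prodℕ n f ℕ.* f n

-- γ_n = |GL_n(F_q)| = ∏_{i=0}^{n-1} (q^n - q^i)
γ : ℕ → ℕ → ℕ
γ q n = prodℕ n (λ i → q ^ n ∸ q ^ i)

-- Formal power series in two variables x, y over ℚ:
-- S n k is the coefficient of x^n y^k.

FPS₂ : Set
FPS₂ = ℕ → ℕ → ℚ

oneS : FPS₂
oneS zero zero = 1ℚ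
oneS _    _    = 0ℚ

_⊛_ : FPS₂ → FPS₂ → FPS₂
(A ⊛ B) n k = sumℚ (suc n) (λ i → sumℚ (suc k) (λ j → A i j *ℚ B (n ∸ i) (k ∸ j)))

powS : FPS₂ → ℕ → FPS₂
powS S zero    = oneS
powS S (suc j) = powS S j ⊛ S

-- exp(S) = Σ_j S^j / j!  for a series S with zero constant term
-- (then only j ≤ n + k contribute to the coefficient of x^n y^k).
expS : FPS₂ → FPS₂
expS S n k = sumℚ (suc (n ℕ.+ k)) (λ j → (1 // (j !)) *ℚ powS S j n k)

-- q-exponential families.  deck n is the list of pictures of the deck D_n
-- (the standard cards of D_n are Q(E_n, p) for p in deck n).  There is no
-- deck D_0, encoded by deck 0 ≡ [].

record QExpFamily (P : Set) : Set where
  field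
    deck     : ℕ → List P
    deck-0   : deck 0 ≡ []
    deck-pic : ∀ n → Unique (deck n)

  d : ℕ → ℕ
  d n = length (deck n)

module LinAlg (𝔽 : FiniteField) where
  open FiniteField 𝔽

  Vect : ℕ → Set
  Vect n = Vec F n

  0V : ∀ {n} → Vect n
  0V = replicate _ 0#

  _+V_ : ∀ {n} → Vect n → Vect n → Vect n
  _+V_ = zipWith _+_

  _·V_ : ∀ {n} → F → Vect n → Vect n
  a ·V v = V.map (a *_) v

  linComb : ∀ {n d} → Vec F d → Vec (Vect n) d → Vect n
  linComb []       []       = 0V
  linComb (c ∷ cs) (b ∷ bs) = (c ·V b) +V linComb cs bs

  sumFin : ∀ {n} k → (Fin k → Vect n) → Vect n
  sumFin zero    w = 0V
  sumFin (suc k) w = w Fin.zero +V sumFin k (λ i → w (Fin.suc i))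
    where import Data.Fin as Fin

  record Subspace (n : ℕ) : Set where
    field
      mem       : Vect n → Bool
      mem-0     : mem 0V ≡ true
      mem-+     : ∀ u v → mem u ≡ true → mem v ≡ true → mem (u +V v) ≡ true
      mem-scale : ∀ a v → mem v ≡ true → mem (a ·V v) ≡ true
  open Subspace public

  _∈S_ : ∀ {n} → Vect n → Subspace n → Set
  v ∈S V = mem V v ≡ true

  _≈S_ : ∀ {n} → Subspace n → Subspace n → Set
  V ≈S W = ∀ v → mem V v ≡ mem W v

  LinIndep : ∀ {n d} → Vec (Vect n) d → Set
  LinIndep {d = d} bs = ∀ (cs : Vec F d) → linComb cs bs ≡ 0V → cs ≡ replicate d 0#

  IsBasis : ∀ {n d} → Subspace n → Vec (Vect n) d → Set
  IsBasis {d = d} V bs =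
    LinIndep bs
    × (∀ i → V.lookup bs i ∈S V)
    × (∀ v → v ∈S V → ∃[ cs ] (linComb cs bs ≡ v))

  HasDim : ∀ {n} → Subspace n → ℕ → Set
  HasDim {n} V d = Σ (Vec (Vect n) d) (IsBasis V)

  IsDirectSumDecomp : ∀ {n} k → (Fin k → Subspace n) → Set
  IsDirectSumDecomp {n} k Vs =
    (∀ (v : Vect n) → ∃[ w ] ((∀ i → w i ∈S Vs i) × sumFin k w ≡ v))
    × (∀ (w w′ : Fin k → Vect n) → (∀ i → w i ∈S Vs i) → (∀ i → w′ i ∈S Vs i)
         → sumFin k w ≡ sumFin k w′ → ∀ i → w i ≡ w′ i)

module Hands (𝔽 : FiniteField) {P : Set} (𝓕 : QExpFamily P) where
  open LinAlg 𝔽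
  open QExpFamily 𝓕

  -- A card Q(V, p) with label space V ⊆ E_n which is a relabeling of a card
  -- of some deck of 𝓕, i.e. p is a picture of the deck D_{dim V}.
  record Card (n : ℕ) : Set where
    field
      space  : Subspace n
      dim    : ℕ
      hasDim : HasDim space dim
      pic    : P
      inDeck : pic ∈ deck dim
  open Card public

  _≈C_ : ∀ {n} → Card n → Card n → Set
  c ≈C c′ = (space c ≈S space c′) × (pic c ≡ pic c′)

  record Hand (n k : ℕ) : Set where
    field
      cards  : Fin k → Card n
      direct : IsDirectSumDecomp k (λ i → space (cards i))
  open Hand public

  -- hands are finite *sets* of cards: equal iff same cards up to reordering
  _≈H_ : ∀ {n k} → Hand n k → Hand n k → Set
  _≈H_ {k = k} H H′ =
    Σ (Permutation′ k) λ π → ∀ i → cards H i ≈C cards H′ (π ⟨$⟩ʳ i)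

HasCount : (A : Set) → (A → A → Set) → ℕ → Set
HasCount A _≈_ m =
  Σ (Fin m → A) λ f →
    (∀ i j → f i ≈ f j → i ≡ j) × (∀ a → ∃[ i ] (a ≈ f i))

module Enumerators (𝔽 : FiniteField) {P : Set} (𝓕 : QExpFamily P) where
  open FiniteField 𝔽 using (q)
  open QExpFamily 𝓕 using (d)

  handEnum : (ℕ → ℕ → ℕ) → FPS₂
  handEnum h n k = h n k // γ q n

  -- y 𝒟(x) = Σ_{n≥1} d_n / γ_n x^n y   (d_0 = 0)
  yDeckEnum : FPS₂
  yDeckEnum n (suc zero) = d n // γ q n
  yDeckEnum n _          = 0ℚ

module Submission where

-- Count framed hands: ordered hands together with an ordered basis of every label
-- space, each weighted by ∏ 1/γ_{dim}.  Summing over the hands first gives k! h(n,k),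
-- because the γ_{dim V} bases of each label space V cancel the weight and because the k
-- cards of a hand are distinct.  On the other hand, the bases of the label spaces
-- concatenate to a basis of E_n, so a framed hand is one of the γ_n ordered bases of
-- E_n cut into k consecutive blocks, a block of size m labelled by a picture of D_m;
-- this gives γ_n [x^n] 𝒟(x)^k.

open import Defs
open import Data.Nat as ℕ using (ℕ; zero; suc; _∸_; _^_; _≤_; _<_; z≤n; s≤s; _!)
import Data.Nat.Properties as ℕₚ
open import Data.Integer as ℤ using (+_)
import Data.Integer.Properties as ℤₚ
open import Data.Rational using (ℚ; 0ℚ; 1ℚ; toℚᵘ) renaming (_+_ to _+ℚ_; _*_ to _*ℚ_)
import Data.Rational.Properties as ℚₚ
import Data.Rational.Unnormalised as ℚᵘ
import Data.Rational.Unnormalised.Properties as ℚᵘₚ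
open import Data.List using (List; []; _∷_; [_]; _++_; map; concatMap; length; filter; allFin)
import Data.List.Properties as Listₚ
open import Data.List.Membership.Propositional using (_∈_; find; lose)
open import Data.List.Membership.Propositional.Properties
open import Data.List.Membership.Propositional.Properties.WithK using (unique∧set⇒bag)
open import Data.List.Relation.Binary.BagAndSetEquality using (∼bag⇒↭)
open import Data.List.Relation.Binary.Permutation.Propositional using (_↭_; refl; prep; swap; trans)
open import Data.List.Relation.Binary.Permutation.Propositional.Properties using (↭-length)
open import Data.List.Relation.Unary.All as All using (All; []; _∷_)
import Data.List.Relation.Unary.All.Properties as Allₚ
open import Data.List.Relation.Unary.Any using (here; there)
open import Data.List.Relation.Unary.AllPairs as AllPairs using (AllPairs; []; _∷_)
import Data.List.Relation.Unary.AllPairs.Properties as AllPairsₚ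
open import Data.List.Relation.Unary.Unique.Propositional using (Unique)
import Data.List.Relation.Unary.Unique.Propositional.Properties as Uniqueₚ
open import Data.Product using (_×_; _,_; proj₁; proj₂; ∃-syntax)
open import Function using (_∘_; id; mk⇔)
open import Relation.Binary.PropositionalEquality using (_≡_; _≢_; refl; sym; cong; cong₂; subst; isEquivalence; module ≡-Reasoning) renaming (trans to ≡-trans)
open import Relation.Nullary using (¬_; ¬?; Dec; does; yes; no; contradiction)
open import Data.Bool using (true; false)
import Data.Bool.Properties as Boolₚ
open import Data.Fin as Fin using (Fin)
open import Data.Fin.Patterns using (0F)
import Data.Fin.Properties as Finₚ
open import Data.Fin.Permutation as Perm using (Permutation′; _⟨$⟩ʳ_; _⟨$⟩ˡ_)
open import Data.Unit using (⊤; tt)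
open import Data.Vec as Vec using (Vec; []; _∷_; lookup; toList; fromList)
import Data.Vec.Properties as Vecₚ
open import Algebra.Bundles using (AbelianGroup; CommutativeRing)
import Algebra.Properties.AbelianGroup as AbelianGroupProperties
import Algebra.Properties.CommutativeMonoid.Sum as CommutativeMonoidSum
import Algebra.Properties.Ring as RingProperties
open import Relation.Nullary.Decidable using (map′; dec-true)
open import Data.List.Membership.DecPropositional using () renaming (_∈?_ to member?)
open import Data.Sum using (inj₁; inj₂; [_,_]′)
open import Relation.Binary.Definitions using (tri<; tri≈; tri>)
open import Data.Vec.Relation.Unary.All using ([]; _∷_) renaming (All to VecAll)

-- Hands are compared only up to `≈H`: a `Card` carries proofs, and its label space is a
-- `Bool`-valued function. Repetition-free lists are therefore made of something more concrete. A
-- frame is a `Vec` of blocks, each a list of vectors with a picture, and the predicate `Good`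
-- describes these without mentioning subspaces. Both counts list this one predicate, and two
-- repetition-free lists of the same predicate are permutations of each other, so their total
-- weights agree. The weights compensate for label spaces whose dimensions vary from hand to hand.
-- The cards of a hand are distinct because D_0 is empty: label spaces are nonzero, and a direct sum
-- cannot contain a nonzero space twice.

private
  variable
    A B : Set

does⁻ : (a? : Dec A) → does a? ≡ true → A
does⁻ (yes a) _ = a

-- Finite enumerations

record _Enumerates_ (xs : List A) (Q : A → Set) : Set where
  field
    unique   : Unique xs
    sound    : ∀ {z} → z ∈ xs → Q z
    complete : ∀ {z} → Q z → z ∈ xs
open _Enumerates_

-- Uniqueness and equal membership force equal multiplicities, so no decision procedure for equality
-- on `A`, in particular on pictures, is involved.
enumerations-↭ : ∀ {xs ys : List A} {Q} → xs Enumerates Q → ys Enumerates Q → xs ↭ ys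
enumerations-↭ p q = ∼bag⇒↭ (unique∧set⇒bag (unique p) (unique q)
  (mk⇔ (complete q ∘ sound p) (complete p ∘ sound q)))

enumerations-length : ∀ {xs ys : List A} {Q} → xs Enumerates Q → ys Enumerates Q →
                      length xs ≡ length ys
enumerations-length p q = ↭-length (enumerations-↭ p q)

∈-concatMap⁺′ : ∀ (f : A → List B) {x y xs} → x ∈ xs → y ∈ f x → y ∈ concatMap f xs
∈-concatMap⁺′ f x∈ y∈ = ∈-concatMap⁺ f (lose x∈ y∈)

∈-concatMap⁻′ : ∀ (f : A → List B) {y} xs → y ∈ concatMap f xs → ∃[ x ] (x ∈ xs × y ∈ f x)
∈-concatMap⁻′ f xs y∈ = find (∈-concatMap⁻ f {xs = xs} y∈)

-- Both relations are left open: permutations are separated by the negation of `Perm.≈`, vectors of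
-- blocks by `≢`.
allPairs-concatMap : ∀ {S : A → A → Set} {R : B → B → Set} (f : A → List B) {xs} →
  AllPairs S xs → (∀ {a} → a ∈ xs → AllPairs R (f a)) →
  (∀ {a a′ c c′} → S a a′ → c ∈ f a → c′ ∈ f a′ → R c c′) →
  AllPairs R (concatMap f xs)
allPairs-concatMap f Sxs inner cross = AllPairsₚ.concat⁺
  (Allₚ.map⁺ (All.tabulate inner))
  (AllPairsₚ.map⁺ (AllPairs.map (λ s → All.tabulate λ c∈ → All.tabulate λ c′∈ → cross s c∈ c′∈) Sxs))

unique-concatMap : ∀ (f : A → List B) {xs} → Unique xs →
  (∀ {a} → a ∈ xs → Unique (f a)) →
  (∀ {a a′ c} → c ∈ f a → c ∈ f a′ → a ≡ a′) →
  Unique (concatMap f xs)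
unique-concatMap f xs! inner cross =
  allPairs-concatMap f xs! inner λ { a≢a′ c∈ c∈′ refl → a≢a′ (cross c∈ c∈′) }

length-concatMap : ∀ (f : A → List B) xs {c} → (∀ {a} → a ∈ xs → length (f a) ≡ c) →
                   length (concatMap f xs) ≡ length xs ℕ.* c
length-concatMap f []       h = refl
length-concatMap f (x ∷ xs) h = ≡-trans (Listₚ.length-++ (f x))
  (cong₂ ℕ._+_ (h (here refl)) (length-concatMap f xs (h ∘ there)))

-- Rational arithmetic

//-toℚᵘ : ∀ a b → toℚᵘ (a // suc b) ℚᵘ.≃ ℚᵘ.mkℚᵘ (+ a) b
//-toℚᵘ a b = ℚₚ.toℚᵘ-fromℚᵘ (ℚᵘ.mkℚᵘ (+ a) b)

-- True for b = 0 as well, since `//` then returns 0 on both sides.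
//-as-product : ∀ a b → a // b ≡ (a // 1) *ℚ (1 // b)
//-as-product a zero    = sym (ℚₚ.*-zeroʳ (a // 1))
//-as-product a (suc b) = ℚₚ.toℚᵘ-injective (begin
  toℚᵘ (a // suc b)                        ≈⟨ //-toℚᵘ a b ⟩
  ℚᵘ.mkℚᵘ (+ a) b                          ≈⟨ ℚᵘ.*≡* (cong₂ ℤ._*_ (sym (ℤₚ.*-identityʳ (+ a))) (cong (+_ ∘ suc) (ℕₚ.+-identityʳ b))) ⟩
  ℚᵘ.mkℚᵘ (+ a) 0 ℚᵘ.* ℚᵘ.mkℚᵘ (+ 1) b     ≈⟨ ℚᵘₚ.*-cong (//-toℚᵘ a 0) (//-toℚᵘ 1 b) ⟨
  toℚᵘ (a // 1) ℚᵘ.* toℚᵘ (1 // suc b)     ≈⟨ ℚₚ.toℚᵘ-homo-* (a // 1) (1 // suc b) ⟨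
  toℚᵘ ((a // 1) *ℚ (1 // suc b))          ∎)
  where open ℚᵘₚ.≃-Reasoning

//1-suc : ∀ a → suc a // 1 ≡ 1ℚ +ℚ (a // 1)
//1-suc a = ℚₚ.toℚᵘ-injective (begin
  toℚᵘ (suc a // 1)                       ≈⟨ //-toℚᵘ (suc a) 0 ⟩
  ℚᵘ.mkℚᵘ (+ suc a) 0                     ≈⟨ ℚᵘ.*≡* (cong (λ t → (+ 1 ℤ.+ t) ℤ.* + 1) (sym (ℤₚ.*-identityʳ (+ a)))) ⟩
  ℚᵘ.mkℚᵘ (+ 1) 0 ℚᵘ.+ ℚᵘ.mkℚᵘ (+ a) 0    ≈⟨ ℚᵘₚ.+-cong (ℚᵘₚ.≃-refl {toℚᵘ 1ℚ}) (//-toℚᵘ a 0) ⟨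
  toℚᵘ 1ℚ ℚᵘ.+ toℚᵘ (a // 1)              ≈⟨ ℚₚ.toℚᵘ-homo-+ 1ℚ (a // 1) ⟨
  toℚᵘ (1ℚ +ℚ (a // 1))                   ∎)
  where open ℚᵘₚ.≃-Reasoning

n//n≡1 : ∀ n → n ≢ 0 → n // n ≡ 1ℚ
n//n≡1 zero    n≢0 = contradiction refl n≢0
n//n≡1 (suc n) _   = ℚₚ.toℚᵘ-injective (begin
  toℚᵘ (suc n // suc n)   ≈⟨ //-toℚᵘ (suc n) n ⟩
  ℚᵘ.mkℚᵘ (+ suc n) n     ≈⟨ ℚᵘ.*≡* (ℤₚ.*-comm (+ suc n) (+ 1)) ⟩
  toℚᵘ 1ℚ                 ∎)
  where open ℚᵘₚ.≃-Reasoning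

//1-*-1// : ∀ n → n ≢ 0 → (n // 1) *ℚ (1 // n) ≡ 1ℚ
//1-*-1// n n≢0 = ≡-trans (sym (//-as-product n n)) (n//n≡1 n n≢0)

-- Sums over lists

sumOver : (A → ℚ) → List A → ℚ
sumOver w []       = 0ℚ
sumOver w (x ∷ xs) = w x +ℚ sumOver w xs

sumOver-cong : ∀ {w w′ : A → ℚ} xs → (∀ {x} → x ∈ xs → w x ≡ w′ x) → sumOver w xs ≡ sumOver w′ xs
sumOver-cong []       h = refl
sumOver-cong (x ∷ xs) h = cong₂ _+ℚ_ (h (here refl)) (sumOver-cong xs (h ∘ there))

sumOver-++ : ∀ (w : A → ℚ) xs ys → sumOver w (xs ++ ys) ≡ sumOver w xs +ℚ sumOver w ys
sumOver-++ w []       ys = sym (ℚₚ.+-identityˡ _)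
sumOver-++ w (x ∷ xs) ys = ≡-trans (cong (w x +ℚ_) (sumOver-++ w xs ys)) (sym (ℚₚ.+-assoc (w x) _ _))

sumOver-concatMap : ∀ (w : B → ℚ) (f : A → List B) xs →
                    sumOver w (concatMap f xs) ≡ sumOver (λ a → sumOver w (f a)) xs
sumOver-concatMap w f []       = refl
sumOver-concatMap w f (x ∷ xs) =
  ≡-trans (sumOver-++ w (f x) (concatMap f xs)) (cong (sumOver w (f x) +ℚ_) (sumOver-concatMap w f xs))

sumOver-map : ∀ (w : B → ℚ) (f : A → B) xs → sumOver w (map f xs) ≡ sumOver (w ∘ f) xs
sumOver-map w f []       = refl
sumOver-map w f (x ∷ xs) = cong (w (f x) +ℚ_) (sumOver-map w f xs)

sumOver-const : ∀ c (xs : List A) → sumOver (λ _ → c) xs ≡ (length xs // 1) *ℚ c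
sumOver-const c []       = sym (ℚₚ.*-zeroˡ c)
sumOver-const c (x ∷ xs) = begin
  c +ℚ sumOver (λ _ → c) xs            ≡⟨ cong₂ _+ℚ_ (sym (ℚₚ.*-identityˡ c)) (sumOver-const c xs) ⟩
  1ℚ *ℚ c +ℚ (length xs // 1) *ℚ c     ≡⟨ ℚₚ.*-distribʳ-+ c 1ℚ (length xs // 1) ⟨
  (1ℚ +ℚ (length xs // 1)) *ℚ c        ≡⟨ cong (_*ℚ c) (//1-suc (length xs)) ⟨
  (suc (length xs) // 1) *ℚ c          ∎
  where open ≡-Reasoning

sumOver-*ʳ : ∀ (w : A → ℚ) c xs → sumOver (λ a → w a *ℚ c) xs ≡ sumOver w xs *ℚ c
sumOver-*ʳ w c []       = sym (ℚₚ.*-zeroˡ c)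
sumOver-*ʳ w c (x ∷ xs) =
  ≡-trans (cong (w x *ℚ c +ℚ_) (sumOver-*ʳ w c xs)) (sym (ℚₚ.*-distribʳ-+ c (w x) _))

sumOver-↭ : ∀ (w : A → ℚ) {xs ys} → xs ↭ ys → sumOver w xs ≡ sumOver w ys
sumOver-↭ w refl         = refl
sumOver-↭ w (prep x p)   = cong (w x +ℚ_) (sumOver-↭ w p)
sumOver-↭ w {_ ∷ _ ∷ xs} {_ ∷ _ ∷ ys} (swap x y p) = begin
  w x +ℚ (w y +ℚ sumOver w xs)   ≡⟨ ℚₚ.+-assoc (w x) (w y) _ ⟨
  (w x +ℚ w y) +ℚ sumOver w xs   ≡⟨ cong₂ _+ℚ_ (ℚₚ.+-comm (w x) (w y)) (sumOver-↭ w p) ⟩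
  (w y +ℚ w x) +ℚ sumOver w ys   ≡⟨ ℚₚ.+-assoc (w y) (w x) _ ⟩
  w y +ℚ (w x +ℚ sumOver w ys)   ∎
  where open ≡-Reasoning
sumOver-↭ w (trans p q)  = ≡-trans (sumOver-↭ w p) (sumOver-↭ w q)

-- Sums over initial segments and power series

sumℚ-cong : ∀ n {f g : ℕ → ℚ} → (∀ {i} → i < n → f i ≡ g i) → sumℚ n f ≡ sumℚ n g
sumℚ-cong zero    h = refl
sumℚ-cong (suc n) h = cong₂ _+ℚ_ (sumℚ-cong n (h ∘ ℕₚ.m<n⇒m<1+n)) (h ℕₚ.≤-refl)

sumℚ-zero : ∀ n {f : ℕ → ℚ} → (∀ {i} → i < n → f i ≡ 0ℚ) → sumℚ n f ≡ 0ℚ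
sumℚ-zero zero    h = refl
sumℚ-zero (suc n) h = ≡-trans
  (cong₂ _+ℚ_ (sumℚ-zero n (h ∘ ℕₚ.m<n⇒m<1+n)) (h ℕₚ.≤-refl)) (ℚₚ.+-identityˡ 0ℚ)

sumℚ-single : ∀ n {f : ℕ → ℚ} i₀ → i₀ < n → (∀ {i} → i < n → i ≢ i₀ → f i ≡ 0ℚ) → sumℚ n f ≡ f i₀
sumℚ-single (suc n) {f} i₀ i₀<1+n h with i₀ ℕ.≟ n
... | yes refl = ≡-trans
  (cong (_+ℚ f n) (sumℚ-zero n λ i<n → h (ℕₚ.m<n⇒m<1+n i<n) (ℕₚ.<⇒≢ i<n))) (ℚₚ.+-identityˡ _)
... | no i₀≢n = ≡-trans
  (cong₂ _+ℚ_ (sumℚ-single n i₀ (ℕₚ.≤∧≢⇒< (ℕₚ.≤-pred i₀<1+n) i₀≢n) (h ∘ ℕₚ.m<n⇒m<1+n))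
              (h ℕₚ.≤-refl (i₀≢n ∘ sym)))
  (ℚₚ.+-identityʳ _)

sumℚ-head : ∀ n (f : ℕ → ℚ) → sumℚ (suc n) f ≡ f 0 +ℚ sumℚ n (f ∘ suc)
sumℚ-head zero    f = ℚₚ.+-comm 0ℚ (f 0)
sumℚ-head (suc n) f = ≡-trans (cong (_+ℚ f (suc n)) (sumℚ-head n f)) (ℚₚ.+-assoc (f 0) _ _)

module _ (S : FPS₂) (linear : ∀ n {j} → j ≢ 1 → S n j ≡ 0ℚ) where

  -- `linear` says that S is y times a series in x, so S^m is y^m times a series in x: a nonzero
  -- term of the Cauchy product needs j = m and k - j = 1, hence k = m + 1.
  powS-off-diagonal : ∀ m n {k} → k ≢ m → powS S m n k ≡ 0ℚ
  powS-off-diagonal zero    zero    {zero}  k≢m = contradiction refl k≢m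
  powS-off-diagonal zero    zero    {suc k} k≢m = refl
  powS-off-diagonal zero    (suc n) {k}     k≢m = refl
  powS-off-diagonal (suc m) n {k} k≢1+m =
    sumℚ-zero (suc n) λ {i} _ → sumℚ-zero (suc k) λ {j} j<1+k → term i j (ℕₚ.≤-pred j<1+k)
    where
    term : ∀ i j → j ≤ k → powS S m i j *ℚ S (n ∸ i) (k ∸ j) ≡ 0ℚ
    term i j j≤k with j ℕ.≟ m
    ... | no j≢m = ≡-trans (cong (_*ℚ _) (powS-off-diagonal m i j≢m)) (ℚₚ.*-zeroˡ (S (n ∸ i) (k ∸ j)))
    ... | yes refl = ≡-trans (cong (powS S m i m *ℚ_) (linear (n ∸ i) λ k∸m≡1 → k≢1+m
            (≡-trans (sym (ℕₚ.m∸n+n≡m j≤k)) (cong (ℕ._+ m) k∸m≡1)))) (ℚₚ.*-zeroʳ (powS S m i m))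

  -- In the y-direction only j = m survives. It leaves y-degree (m + 1) - m = 1 for the last factor
  -- and a Cauchy product in x alone.
  powS-diagonal : ∀ m n → powS S (suc m) n (suc m) ≡ sumℚ (suc n) (λ i → powS S m i m *ℚ S (n ∸ i) 1)
  powS-diagonal m n = sumℚ-cong (suc n) λ {i} _ → ≡-trans
    (sumℚ-single (suc (suc m)) m (s≤s (ℕₚ.n≤1+n m)) λ {j} _ j≢m →
      ≡-trans (cong (_*ℚ S (n ∸ i) (suc m ∸ j)) (powS-off-diagonal m i j≢m)) (ℚₚ.*-zeroˡ (S (n ∸ i) (suc m ∸ j))))
    (cong (λ t → powS S m i m *ℚ S (n ∸ i) t) (ℕₚ.m+n∸n≡m 1 m))

  -- The truncation bound n + k is at least k, so the one surviving power j = k is in range.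
  expS-diagonal : ∀ n k → expS S n k ≡ (1 // (k !)) *ℚ powS S k n k
  expS-diagonal n k = sumℚ-single (suc (n ℕ.+ k)) k (s≤s (ℕₚ.m≤n+m k n)) λ {j} _ j≢k →
    ≡-trans (cong ((1 // (j !)) *ℚ_) (powS-off-diagonal j n (j≢k ∘ sym))) (ℚₚ.*-zeroʳ (1 // (j !)))

-- Permutations

insert-injective : ∀ {k j j′} (π π′ : Permutation′ k) →
  Perm.insert 0F j π Perm.≈ Perm.insert 0F j′ π′ → j ≡ j′ × π Perm.≈ π′
insert-injective {j = j} π π′ eq with eq 0F
... | refl = refl , λ i → Finₚ.punchIn-injective j _ _
  (≡-trans (sym (Perm.insert-punchIn 0F j π i)) (≡-trans (eq (Fin.suc i)) (Perm.insert-punchIn 0F j π′ i)))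

insert-cong : ∀ {k} j (π π′ : Permutation′ k) → π Perm.≈ π′ → Perm.insert 0F j π Perm.≈ Perm.insert 0F j π′
insert-cong j π π′ eq 0F          = refl
insert-cong j π π′ eq (Fin.suc i) = cong (Fin.punchIn j) (eq i)

insertions : ∀ {k} → List (Permutation′ k) → Fin (suc k) → List (Permutation′ (suc k))
insertions πs j = map (Perm.insert 0F j) πs

-- A permutation of k + 1 points amounts to the image j of 0 and a permutation of the other k
-- points, whence (k + 1) k! of them.
permutations : ∀ k → List (Permutation′ k)
permutations zero    = [ Perm.id ]
permutations (suc k) = concatMap (insertions (permutations k)) (allFin (suc k))

permutations-length : ∀ k → length (permutations k) ≡ k !
permutations-length zero    = refl
permutations-length (suc k) = ≡-trans
  (length-concatMap (insertions (permutations k)) (allFin (suc k)) λ {j} _ →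
    ≡-trans (Listₚ.length-map (Perm.insert 0F j) (permutations k)) (permutations-length k))
  (cong (ℕ._* k !) (Listₚ.length-tabulate {n = suc k} id))

-- `Permutation′` is a record of functions and proofs, so distinctness and completeness are both
-- stated up to pointwise agreement.
permutations-distinct : ∀ k → AllPairs (λ π π′ → ¬ π Perm.≈ π′) (permutations k)
permutations-distinct zero    = [] ∷ []
permutations-distinct (suc k) = allPairs-concatMap (insertions (permutations k)) (Uniqueₚ.allFin⁺ (suc k))
  (λ {j} _ → AllPairsₚ.map⁺ (AllPairs.map (λ {π} {π′} π≉π′ eq → π≉π′ (proj₂ (insert-injective π π′ eq)))
    (permutations-distinct k)))
  cross
  where
  cross : ∀ {j j′ σ σ′} → j ≢ j′ → σ ∈ insertions (permutations k) j →
          σ′ ∈ insertions (permutations k) j′ → ¬ σ Perm.≈ σ′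
  cross {j} {j′} j≢j′ σ∈ σ′∈ eq
    with ∈-map⁻ (Perm.insert 0F j) σ∈ | ∈-map⁻ (Perm.insert 0F j′) σ′∈
  ... | π , _ , refl | π′ , _ , refl = j≢j′ (proj₁ (insert-injective π π′ eq))

permutations-complete : ∀ k (π : Permutation′ k) → ∃[ ρ ] (ρ ∈ permutations k × ρ Perm.≈ π)
permutations-complete zero    π = Perm.id , here refl , λ ()
permutations-complete (suc k) π with permutations-complete k (Perm.remove 0F π)
... | ρ , ρ∈ , ρ≈ = Perm.insert 0F j ρ
                  , ∈-concatMap⁺′ (insertions (permutations k)) (∈-allFin j) (∈-map⁺ (Perm.insert 0F j) ρ∈)
                  , λ i → ≡-trans (insert-cong j ρ (Perm.remove 0F π) ρ≈ i) (Perm.insert-remove 0F π i)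
  where j = π ⟨$⟩ʳ 0F

-- Finite-dimensional linear algebra

module LinearAlgebra (𝔽 : FiniteField) where
  open FiniteField 𝔽 renaming (complete to elements-complete)
  open LinAlg 𝔽

  fieldRing : CommutativeRing _ _
  fieldRing = record { isCommutativeRing = isCommutativeRing }

  private
    module 𝔽ᵣ = CommutativeRing fieldRing

  V-abelianGroup : ℕ → AbelianGroup _ _
  V-abelianGroup n = record
    { Carrier = Vect n ; _≈_ = _≡_ ; _∙_ = _+V_ ; ε = 0V ; _⁻¹ = Vec.map (-_)
    ; isAbelianGroup = record
      { isGroup = record
        { isMonoid = record
          { isSemigroup = record
            { isMagma = record { isEquivalence = isEquivalence ; ∙-cong = cong₂ _+V_ }
            ; assoc = Vecₚ.zipWith-assoc 𝔽ᵣ.+-assoc }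
          ; identity = Vecₚ.zipWith-identityˡ 𝔽ᵣ.+-identityˡ , Vecₚ.zipWith-identityʳ 𝔽ᵣ.+-identityʳ }
        ; inverse = Vecₚ.zipWith-inverseˡ 𝔽ᵣ.-‿inverseˡ , Vecₚ.zipWith-inverseʳ 𝔽ᵣ.-‿inverseʳ
        ; ⁻¹-cong = cong (Vec.map (-_)) }
      ; comm = Vecₚ.zipWith-comm 𝔽ᵣ.+-comm } }

  module _ {n : ℕ} where
    open AbelianGroup (V-abelianGroup n) public using ()
      renaming (_⁻¹ to -V_; _-_ to _-V_; assoc to +V-assoc; comm to +V-comm; identityˡ to +V-identityˡ;
                identityʳ to +V-identityʳ; inverseʳ to -V-inverseʳ)
    open AbelianGroupProperties (V-abelianGroup n) public using ()
      renaming (∙-cancelˡ to +V-cancelˡ; x∙y⁻¹≈ε⇒x≈y to -V≡0⇒≡)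

  +V-interchange : ∀ {n} (a b c d : Vect n) → (a +V b) +V (c +V d) ≡ (a +V c) +V (b +V d)
  +V-interchange a b c d = begin
    (a +V b) +V (c +V d)   ≡⟨ +V-assoc a b (c +V d) ⟩
    a +V (b +V (c +V d))   ≡⟨ cong (a +V_) (+V-assoc b c d) ⟨
    a +V ((b +V c) +V d)   ≡⟨ cong (λ t → a +V (t +V d)) (+V-comm b c) ⟩
    a +V ((c +V b) +V d)   ≡⟨ cong (a +V_) (+V-assoc c b d) ⟩
    a +V (c +V (b +V d))   ≡⟨ +V-assoc a c (b +V d) ⟨
    (a +V c) +V (b +V d)   ∎
    where open ≡-Reasoning

  +V-transpose : ∀ {n} (a b a′ b′ : Vect n) → a +V b ≡ a′ +V b′ → a -V a′ ≡ b′ -V b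
  +V-transpose a b a′ b′ eq = begin
    a -V a′                          ≡⟨ +V-identityʳ (a -V a′) ⟨
    (a -V a′) +V 0V                  ≡⟨ cong ((a -V a′) +V_) (-V-inverseʳ b) ⟨
    (a +V (-V a′)) +V (b -V b)       ≡⟨ +V-interchange a (-V a′) b (-V b) ⟩
    (a +V b) +V ((-V a′) +V (-V b))  ≡⟨ cong (_+V ((-V a′) +V (-V b))) eq ⟩
    (a′ +V b′) +V ((-V a′) +V (-V b)) ≡⟨ +V-interchange a′ b′ (-V a′) (-V b) ⟩
    (a′ -V a′) +V (b′ -V b)          ≡⟨ cong (_+V (b′ -V b)) (-V-inverseʳ a′) ⟩
    0V +V (b′ -V b)                  ≡⟨ +V-identityˡ (b′ -V b) ⟩
    b′ -V b                          ∎
    where open ≡-Reasoning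

  ·V-distribˡ : ∀ {n} a (u v : Vect n) → a ·V (u +V v) ≡ (a ·V u) +V (a ·V v)
  ·V-distribˡ a []      []      = refl
  ·V-distribˡ a (x ∷ u) (y ∷ v) = cong₂ _∷_ (𝔽ᵣ.distribˡ a x y) (·V-distribˡ a u v)

  ·V-distribʳ : ∀ {n} a b (u : Vect n) → (a + b) ·V u ≡ (a ·V u) +V (b ·V u)
  ·V-distribʳ a b []      = refl
  ·V-distribʳ a b (x ∷ u) = cong₂ _∷_ (𝔽ᵣ.distribʳ x a b) (·V-distribʳ a b u)

  ·V-assoc : ∀ {n} a b (u : Vect n) → (a * b) ·V u ≡ a ·V (b ·V u)
  ·V-assoc a b []      = refl
  ·V-assoc a b (x ∷ u) = cong₂ _∷_ (𝔽ᵣ.*-assoc a b x) (·V-assoc a b u)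

  ·V-identity : ∀ {n} (u : Vect n) → 1# ·V u ≡ u
  ·V-identity []      = refl
  ·V-identity (x ∷ u) = cong₂ _∷_ (𝔽ᵣ.*-identityˡ x) (·V-identity u)

  ·V-zeroˡ : ∀ {n} (u : Vect n) → 0# ·V u ≡ 0V
  ·V-zeroˡ []      = refl
  ·V-zeroˡ (x ∷ u) = cong₂ _∷_ (𝔽ᵣ.zeroˡ x) (·V-zeroˡ u)

  ·V-zeroʳ : ∀ n a → a ·V 0V {n} ≡ 0V
  ·V-zeroʳ zero    a = refl
  ·V-zeroʳ (suc n) a = cong₂ _∷_ (𝔽ᵣ.zeroʳ a) (·V-zeroʳ n a)

  -V-scale : ∀ {n} a (u : Vect n) → -V (a ·V u) ≡ (- a) ·V u
  -V-scale a []      = refl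
  -V-scale a (x ∷ u) = cong₂ _∷_ (RingProperties.-‿distribˡ-* 𝔽ᵣ.ring a x) (-V-scale a u)

  -V≡-1· : ∀ {n} (u : Vect n) → -V u ≡ (- 1#) ·V u
  -V≡-1· u = ≡-trans (cong -V_ (sym (·V-identity u))) (-V-scale 1# u)

  -- Spans and independence of lists of vectors

  Span : ∀ {n} → List (Vect n) → Vect n → Set
  Span []       v = v ≡ 0V
  Span (x ∷ xs) v = ∃[ c ] ∃[ u ] (Span xs u × (c ·V x) +V u ≡ v)

  -- This greedy form of independence lets a list grow by one vector at the front, with q^j excluded
  -- choices after j vectors; its equivalence with `LinIndep` is proved separately.
  Independent : ∀ {n} → List (Vect n) → Set
  Independent []       = ⊤
  Independent (x ∷ xs) = ¬ Span xs x × Independent xs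

  module _ {n : ℕ} where

    span-0 : (xs : List (Vect n)) → Span xs 0V
    span-0 []       = refl
    span-0 (x ∷ xs) = 0# , 0V , span-0 xs , ≡-trans (cong (_+V 0V) (·V-zeroˡ x)) (+V-identityˡ 0V)

    span-+ : (xs : List (Vect n)) → ∀ {u v} → Span xs u → Span xs v → Span xs (u +V v)
    span-+ []       refl refl = +V-identityˡ 0V
    span-+ (x ∷ xs) (c , u , su , refl) (d , v , sv , refl) =
      c + d , u +V v , span-+ xs su sv ,
      ≡-trans (cong (_+V (u +V v)) (·V-distribʳ c d x)) (+V-interchange (c ·V x) (d ·V x) u v)

    span-scale : (xs : List (Vect n)) → ∀ a {u} → Span xs u → Span xs (a ·V u)
    span-scale []       a refl = ·V-zeroʳ n a
    span-scale (x ∷ xs) a (c , u , su , refl) =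
      a * c , a ·V u , span-scale xs a su ,
      ≡-trans (cong (_+V (a ·V u)) (·V-assoc a c x)) (sym (·V-distribˡ a (c ·V x) u))

    span-- : (xs : List (Vect n)) → ∀ {u v} → Span xs u → Span xs v → Span xs (u -V v)
    span-- xs {u} {v} su sv =
      span-+ xs su (subst (Span xs) (sym (-V≡-1· v)) (span-scale xs (- 1#) sv))

    span-there : ∀ x (xs : List (Vect n)) {u} → Span xs u → Span (x ∷ xs) u
    span-there x xs {u} su = 0# , u , su , ≡-trans (cong (_+V u) (·V-zeroˡ x)) (+V-identityˡ u)

    span-here : ∀ x (xs : List (Vect n)) → Span (x ∷ xs) x
    span-here x xs = 1# , 0V , span-0 xs , ≡-trans (+V-identityʳ (1# ·V x)) (·V-identity x)

    -- Were c nonzero, multiplying by its inverse would put x in the span.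
    span-scale⁻ : ∀ {x} (xs : List (Vect n)) {c} → ¬ Span xs x → Span xs (c ·V x) → c ≡ 0#
    span-scale⁻ {x} xs {c} ¬sx sc with c ≟ 0#
    ... | yes c≡0 = c≡0
    ... | no c≢0 with inverse c c≢0
    ...   | c⁻¹ , cc⁻¹≡1 = contradiction (subst (Span xs) c⁻¹cx≡x (span-scale xs c⁻¹ sc)) ¬sx
      where
      c⁻¹cx≡x : c⁻¹ ·V (c ·V x) ≡ x
      c⁻¹cx≡x = ≡-trans (sym (·V-assoc c⁻¹ c x))
        (≡-trans (cong (_·V x) (≡-trans (𝔽ᵣ.*-comm c⁻¹ c) cc⁻¹≡1)) (·V-identity x))

    -- After subtraction, (c - c′) x = u′ - u lies in the span of `xs`, so c - c′ = 0.
    coefficient-unique : ∀ {x} (xs : List (Vect n)) {c c′ u u′} → ¬ Span xs x → Span xs u → Span xs u′ →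
                         (c ·V x) +V u ≡ (c′ ·V x) +V u′ → c ≡ c′
    coefficient-unique {x} xs {c} {c′} {u} {u′} ¬sx su su′ eq =
      RingProperties.x∙y⁻¹≈ε⇒x≈y 𝔽ᵣ.ring c c′ (span-scale⁻ xs ¬sx (subst (Span xs) eq′ (span-- xs su′ su)))
      where
      eq′ : u′ -V u ≡ (c + (- c′)) ·V x
      eq′ = ≡-trans (sym (+V-transpose (c ·V x) u (c′ ·V x) u′ eq))
        (≡-trans (cong ((c ·V x) +V_) (-V-scale c′ x)) (sym (·V-distribʳ c (- c′) x)))

    span-++⁺ : (xs ys : List (Vect n)) → ∀ {u v} → Span xs u → Span ys v → Span (xs ++ ys) (u +V v)
    span-++⁺ []       ys {v = v} refl sv = subst (Span ys) (sym (+V-identityˡ v)) sv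
    span-++⁺ (x ∷ xs) ys {v = v} (c , u , su , refl) sv =
      c , u +V v , span-++⁺ xs ys su sv , sym (+V-assoc (c ·V x) u v)

    span-++⁻ : (xs ys : List (Vect n)) → ∀ {w} → Span (xs ++ ys) w →
               ∃[ u ] ∃[ v ] (Span xs u × Span ys v × u +V v ≡ w)
    span-++⁻ []       ys {w} sw = 0V , w , refl , sw , +V-identityˡ w
    span-++⁻ (x ∷ xs) ys (c , _ , st , refl) with span-++⁻ xs ys st
    ... | u , v , su , sv , refl =
      (c ·V x) +V u , v , (c , u , su , refl) , sv , +V-assoc (c ·V x) u v

    span-++ˡ : (xs ys : List (Vect n)) → ∀ {u} → Span xs u → Span (xs ++ ys) u
    span-++ˡ xs ys {u} su = subst (Span (xs ++ ys)) (+V-identityʳ u) (span-++⁺ xs ys su (span-0 ys))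

    span-++ʳ : (xs ys : List (Vect n)) → ∀ {u} → Span ys u → Span (xs ++ ys) u
    span-++ʳ xs ys {u} su = subst (Span (xs ++ ys)) (+V-identityˡ u) (span-++⁺ xs ys (span-0 xs) su)

    Disjoint : List (Vect n) → List (Vect n) → Set
    Disjoint xs ys = ∀ {v} → Span xs v → Span ys v → v ≡ 0V

    -- If x = u + v with u in the span of `xs` and v in that of `ys`, then v = x - u lies in the
    -- spans of both `x ∷ xs` and `ys`, so v = 0 and x = u, against the independence of `x ∷ xs`.
    independent-++⁺ : (xs ys : List (Vect n)) → Independent xs → Independent ys → Disjoint xs ys →
                      Independent (xs ++ ys)
    independent-++⁺ []       ys _          iys disj = iys
    independent-++⁺ (x ∷ xs) ys (¬sx , ixs) iys disj =
      (λ sx → case (span-++⁻ xs ys sx)) ,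
      independent-++⁺ xs ys ixs iys (λ su → disj (span-there x xs su))
      where
      case : ¬ (∃[ u ] ∃[ v ] (Span xs u × Span ys v × u +V v ≡ x))
      case (u , v , su , sv , u+v≡x) = ¬sx (subst (Span xs) u≡x su)
        where
        v≡x-u : v ≡ x -V u
        v≡x-u = ≡-trans (sym (+V-identityʳ v)) (≡-trans (cong (v +V_) (sym (-V-inverseʳ u)))
          (≡-trans (sym (+V-assoc v u (-V u))) (cong (_+V (-V u)) (≡-trans (+V-comm v u) u+v≡x))))
        v≡0 : v ≡ 0V
        v≡0 = disj (subst (Span (x ∷ xs)) (sym v≡x-u) (span-- (x ∷ xs) (span-here x xs) (span-there x xs su))) sv
        u≡x : u ≡ x
        u≡x = ≡-trans (sym (+V-identityʳ u)) (≡-trans (cong (u +V_) (sym v≡0)) u+v≡x)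

    independent-++⁻ : (xs ys : List (Vect n)) → Independent (xs ++ ys) →
                      Independent xs × Independent ys × Disjoint xs ys
    independent-++⁻ []       ys i = tt , i , λ v≡0 _ → v≡0
    independent-++⁻ (x ∷ xs) ys (¬sx , i) with independent-++⁻ xs ys i
    ... | ixs , iys , disj = ((¬sx ∘ span-++ˡ xs ys) , ixs) , iys , disj′
      where
      disj′ : Disjoint (x ∷ xs) ys
      disj′ {v} (c , u , su , refl) sv = ≡-trans cx+u≡u (disj su (subst (Span ys) cx+u≡u sv))
        where
        -- The vector c x + u lies in the span of `ys` and u in that of `xs`, so c x lies in the
        -- span of `xs ++ ys`; as x does not, c = 0.
        s : Span (xs ++ ys) (((c ·V x) +V u) -V u)
        s = span-- (xs ++ ys) (span-++ʳ xs ys sv) (span-++ˡ xs ys su)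
        c≡0 : c ≡ 0#
        c≡0 = span-scale⁻ (xs ++ ys) ¬sx (subst (Span (xs ++ ys))
          (≡-trans (+V-assoc (c ·V x) u (-V u)) (≡-trans (cong ((c ·V x) +V_) (-V-inverseʳ u)) (+V-identityʳ (c ·V x)))) s)
        cx+u≡u : (c ·V x) +V u ≡ u
        cx+u≡u = ≡-trans (cong (λ t → (t ·V x) +V u) c≡0) (≡-trans (cong (_+V u) (·V-zeroˡ x)) (+V-identityˡ u))

  -- Cardinalities over a finite field

  _≟V_ : ∀ {n} (u v : Vect n) → Dec (u ≡ v)
  _≟V_ = Vecₚ.≡-dec _≟_

  -- Two different elements, `0#` and `1#`, occur in the list. Powers of q are then strictly
  -- increasing, which gives γ ≠ 0 and lets a dimension be read off from a cardinality.
  1<q : 1 < q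
  1<q with elements | elements-complete 0# | elements-complete 1#
  ... | _ ∷ []    | here refl | here 1≡0 = contradiction (sym 1≡0) 0≢1
  ... | _ ∷ _ ∷ _ | _         | _        = s≤s (s≤s z≤n)

  instance
    q-nonZero : ℕ.NonZero q
    q-nonZero = ℕ.>-nonZero (ℕₚ.<-trans (s≤s z≤n) 1<q)

  q^-injective : ∀ {a b} → q ^ a ≡ q ^ b → a ≡ b
  q^-injective {a} {b} eq with ℕₚ.<-cmp a b
  ... | tri< a<b _ _ = contradiction eq (ℕₚ.<⇒≢ (ℕₚ.^-monoʳ-< q 1<q a<b))
  ... | tri≈ _ a≡b _ = a≡b
  ... | tri> _ _ b<a = contradiction (sym eq) (ℕₚ.<⇒≢ (ℕₚ.^-monoʳ-< q 1<q b<a))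

  prodℕ-nonzero : ∀ n {f} → (∀ {i} → i < n → f i ≢ 0) → prodℕ n f ≢ 0
  prodℕ-nonzero (suc n) {f} h eq with ℕₚ.m*n≡0⇒m≡0∨n≡0 (prodℕ n f) eq
  ... | inj₁ e = prodℕ-nonzero n (h ∘ ℕₚ.m<n⇒m<1+n) e
  ... | inj₂ e = h ℕₚ.≤-refl e

  γ-nonzero : ∀ n → γ q n ≢ 0
  γ-nonzero n = prodℕ-nonzero n λ i<n →
    ℕₚ.m>n⇒m∸n≢0 (ℕₚ.^-monoʳ-< q 1<q i<n)

  allVecs : ∀ n → List (Vect n)
  allVecs zero    = [ [] ]
  allVecs (suc n) = concatMap (λ c → map (c ∷_) (allVecs n)) elements

  allVecs-enumerates : ∀ n → allVecs n Enumerates (λ _ → ⊤)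
  allVecs-enumerates zero = record
    { unique = [] ∷ [] ; sound = λ _ → tt ; complete = λ { {[]} _ → here refl } }
  allVecs-enumerates (suc n) = record
    { unique = unique-concatMap (λ c → map (c ∷_) (allVecs n)) distinct
        (λ _ → Uniqueₚ.map⁺ Vecₚ.∷-injectiveʳ (unique (allVecs-enumerates n)))
        (λ v∈ v∈′ → same-head v∈ v∈′)
    ; sound = λ _ → tt
    ; complete = λ { {c ∷ v} _ → ∈-concatMap⁺′ (λ c → map (c ∷_) (allVecs n)) (elements-complete c)
        (∈-map⁺ (c ∷_) (complete (allVecs-enumerates n) {v} tt)) } }
    where
    same-head : ∀ {c c′ v} → v ∈ map (c ∷_) (allVecs n) → v ∈ map (c′ ∷_) (allVecs n) → c ≡ c′
    same-head {c} {c′} v∈ v∈′ with ∈-map⁻ (c ∷_) v∈ | ∈-map⁻ (c′ ∷_) v∈′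
    ... | _ , _ , refl | _ , _ , refl = refl

  allVecs-length : ∀ n → length (allVecs n) ≡ q ^ n
  allVecs-length zero    = refl
  allVecs-length (suc n) = length-concatMap (λ c → map (c ∷_) (allVecs n)) elements
    λ {c} _ → ≡-trans (Listₚ.length-map (c ∷_) (allVecs n)) (allVecs-length n)

  translates : ∀ {n} → Vect n → List (Vect n) → F → List (Vect n)
  translates x us c = map ((c ·V x) +V_) us

  spanList : ∀ {n} → List (Vect n) → List (Vect n)
  spanList []       = [ 0V ]
  spanList (x ∷ xs) = concatMap (translates x (spanList xs)) elements

  spanList-length : ∀ {n} (xs : List (Vect n)) → length (spanList xs) ≡ q ^ length xs
  spanList-length []       = refl
  spanList-length (x ∷ xs) = length-concatMap (translates x (spanList xs)) elements
    λ {c} _ → ≡-trans (Listₚ.length-map ((c ·V x) +V_) (spanList xs)) (spanList-length xs)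

  spanList-sound : ∀ {n} (xs : List (Vect n)) {v} → v ∈ spanList xs → Span xs v
  spanList-sound []       (here refl) = refl
  spanList-sound (x ∷ xs) v∈ with ∈-concatMap⁻′ (translates x (spanList xs)) elements v∈
  ... | c , _ , v∈c with ∈-map⁻ ((c ·V x) +V_) v∈c
  ...   | u , u∈ , refl = c , u , spanList-sound xs u∈ , refl

  spanList-complete : ∀ {n} (xs : List (Vect n)) {v} → Span xs v → v ∈ spanList xs
  spanList-complete []       refl = here refl
  spanList-complete (x ∷ xs) (c , u , su , refl) =
    ∈-concatMap⁺′ (translates x (spanList xs)) (elements-complete c) (∈-map⁺ ((c ·V x) +V_) (spanList-complete xs su))

  spanList-unique : ∀ {n} (xs : List (Vect n)) → Independent xs → Unique (spanList xs)
  spanList-unique []       _           = [] ∷ []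
  spanList-unique (x ∷ xs) (¬sx , ixs) = unique-concatMap (translates x (spanList xs)) distinct
    (λ {c} _ → Uniqueₚ.map⁺ (+V-cancelˡ (c ·V x) _ _) (spanList-unique xs ixs)) same-coefficient
    where
    same-coefficient : ∀ {c c′ v} → v ∈ translates x (spanList xs) c → v ∈ translates x (spanList xs) c′ → c ≡ c′
    same-coefficient {c} {c′} v∈ v∈′ with ∈-map⁻ ((c ·V x) +V_) v∈ | ∈-map⁻ ((c′ ·V x) +V_) v∈′
    ... | u , u∈ , refl | u′ , u′∈ , eq =
      coefficient-unique xs ¬sx (spanList-sound xs u∈) (spanList-sound xs u′∈) eq

  -- Over a finite field a span is a finite list. The decision also supplies the `Bool`-valued
  -- membership of `spanSubspace`.
  span? : ∀ {n} (xs : List (Vect n)) v → Dec (Span xs v)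
  span? xs v = map′ (spanList-sound xs) (spanList-complete xs) (member? _≟V_ v (spanList xs))

  -- Counting the ordered bases of a subspace

  full : ∀ n → Subspace n
  full n = record { mem = λ _ → true ; mem-0 = refl ; mem-+ = λ _ _ _ _ → refl ; mem-scale = λ _ _ _ → refl }

  -- Lists replace the vectors of `IsBasis` because blocks are concatenated and cut without their
  -- lengths being fixed beforehand.
  Basis : ∀ {n} → Subspace n → List (Vect n) → Set
  Basis V xs = Independent xs × (∀ {v} → Span xs v → v ∈S V) × (∀ {v} → v ∈S V → Span xs v)

  module _ {n : ℕ} (V : Subspace n) where

    span-within : ∀ xs {v} → All (_∈S V) xs → Span xs v → v ∈S V
    span-within []       []          refl = mem-0 V
    span-within (x ∷ xs) (x∈ ∷ xs∈) (c , u , su , refl) =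
      mem-+ V _ _ (mem-scale V c x x∈) (span-within xs xs∈ su)

    within-span : ∀ xs → (∀ {v} → Span xs v → v ∈S V) → All (_∈S V) xs
    within-span []       h = []
    within-span (x ∷ xs) h = h (span-here x xs) ∷ within-span xs (h ∘ span-there x xs)

    members : List (Vect n)
    members = filter (λ v → mem V v Boolₚ.≟ true) (allVecs n)

    members-enumerates : members Enumerates (_∈S V)
    members-enumerates = record
      { unique   = Uniqueₚ.filter⁺ _ (unique (allVecs-enumerates n))
      ; sound    = λ v∈ → proj₂ (∈-filter⁻ (λ v → mem V v Boolₚ.≟ true) {xs = allVecs n} v∈)
      ; complete = λ v∈V → ∈-filter⁺ (λ v → mem V v Boolₚ.≟ true) (complete (allVecs-enumerates n) tt) v∈V }

    extensions : List (Vect n) → List (Vect n)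
    extensions xs = filter (λ v → ¬? (span? xs v)) members

    ∈-extensions⁻ : ∀ xs {v} → v ∈ extensions xs → v ∈S V × ¬ Span xs v
    ∈-extensions⁻ xs v∈ with ∈-filter⁻ (λ v → ¬? (span? xs v)) {xs = members} v∈
    ... | v∈m , ¬sv = sound members-enumerates v∈m , ¬sv

    ∈-extensions⁺ : ∀ xs {v} → v ∈S V → ¬ Span xs v → v ∈ extensions xs
    ∈-extensions⁺ xs v∈V ¬sv = ∈-filter⁺ (λ v → ¬? (span? xs v)) (complete members-enumerates v∈V) ¬sv

    -- The members of `V` are the disjoint union of the admissible next vectors and the span of
    -- `xs`. The additive form avoids truncated subtraction.
    extensions-length : ∀ xs → Independent xs → All (_∈S V) xs →
                        length (extensions xs) ℕ.+ q ^ length xs ≡ length members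
    extensions-length xs ixs xs∈ = ≡-trans
      (≡-trans (cong (length (extensions xs) ℕ.+_) (sym (spanList-length xs))) (sym (Listₚ.length-++ (extensions xs))))
      (enumerations-length split members-enumerates)
      where
      split : (extensions xs ++ spanList xs) Enumerates (_∈S V)
      split = record
        { unique = Uniqueₚ.++⁺ (Uniqueₚ.filter⁺ _ (unique members-enumerates)) (spanList-unique xs ixs)
            λ { (v∈ , v∈′) → proj₂ (∈-extensions⁻ xs v∈) (spanList-sound xs v∈′) }
        ; sound = λ v∈ → [ proj₁ ∘ ∈-extensions⁻ xs , span-within xs xs∈ ∘ spanList-sound xs ]′ (∈-++⁻ (extensions xs) v∈)
        ; complete = λ {v} v∈V → case′ v v∈V (span? xs v) }
        where
        case′ : ∀ v → v ∈S V → Dec (Span xs v) → v ∈ extensions xs ++ spanList xs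
        case′ v v∈V (yes sv) = ∈-++⁺ʳ (extensions xs) (spanList-complete xs sv)
        case′ v v∈V (no ¬sv) = ∈-++⁺ˡ (∈-extensions⁺ xs v∈V ¬sv)

    consExtensions : List (Vect n) → List (List (Vect n))
    consExtensions xs = map (_∷ xs) (extensions xs)

    independentLists : ℕ → List (List (Vect n))
    independentLists zero    = [ [] ]
    independentLists (suc j) = concatMap consExtensions (independentLists j)

    independentLists-enumerates : ∀ j → independentLists j Enumerates
      (λ xs → length xs ≡ j × Independent xs × All (_∈S V) xs)
    independentLists-enumerates zero = record
      { unique = [] ∷ [] ; sound = λ { (here refl) → refl , tt , [] } ; complete = λ { {[]} _ → here refl } }
    independentLists-enumerates (suc j) = record
      { unique = unique-concatMap consExtensions (unique IH)
          (λ {xs} _ → Uniqueₚ.map⁺ Listₚ.∷-injectiveˡ (Uniqueₚ.filter⁺ _ (unique members-enumerates))) same-tail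
      ; sound = λ xs∈ → sound′ xs∈
      ; complete = λ { {x ∷ xs} (len , (¬sx , ixs) , (x∈ ∷ xs∈)) →
          ∈-concatMap⁺′ consExtensions (complete IH (ℕₚ.suc-injective len , ixs , xs∈))
            (∈-map⁺ (_∷ xs) (∈-extensions⁺ xs x∈ ¬sx)) } }
      where
      IH = independentLists-enumerates j
      same-tail : ∀ {xs xs′ zs} → zs ∈ consExtensions xs → zs ∈ consExtensions xs′ → xs ≡ xs′
      same-tail {xs} {xs′} zs∈ zs∈′ with ∈-map⁻ (_∷ xs) zs∈ | ∈-map⁻ (_∷ xs′) zs∈′
      ... | _ , _ , refl | _ , _ , refl = refl
      sound′ : ∀ {zs} → zs ∈ independentLists (suc j) → length zs ≡ suc j × Independent zs × All (_∈S V) zs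
      sound′ zs∈ with ∈-concatMap⁻′ consExtensions (independentLists j) zs∈
      ... | xs , xs∈ , zs∈′ with ∈-map⁻ (_∷ xs) zs∈′ | sound IH xs∈
      ...   | x , x∈ , refl | len , ixs , within with ∈-extensions⁻ xs x∈
      ...     | x∈V , ¬sx = cong suc len , (¬sx , ixs) , (x∈V ∷ within)

    -- The number of extensions depends only on the length of the list extended. When `V` has q^d
    -- members and j = d, the product is γ_d.
    independentLists-length : ∀ j → length (independentLists j) ≡ prodℕ j (λ i → length members ∸ q ^ i)
    independentLists-length zero    = refl
    independentLists-length (suc j) = ≡-trans
      (length-concatMap consExtensions (independentLists j) count)
      (cong (ℕ._* (length members ∸ q ^ j)) (independentLists-length j))
      where
      count : ∀ {xs} → xs ∈ independentLists j → length (consExtensions xs) ≡ length members ∸ q ^ j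
      count {xs} xs∈ with sound (independentLists-enumerates j) xs∈
      ... | refl , ixs , within = ≡-trans (Listₚ.length-map (_∷ xs) (extensions xs))
        (≡-trans (sym (ℕₚ.m+n∸n≡m _ (q ^ length xs))) (cong (_∸ q ^ length xs) (extensions-length xs ixs within)))

    -- The combinations of a basis run through `V` without repetition. This count replaces the
    -- exchange lemma: as q^d determines d, all bases of `V` have the same length.
    basis-size : ∀ {xs} → Basis V xs → length members ≡ q ^ length xs
    basis-size {xs} (ixs , s⇒V , V⇒s) = ≡-trans
      (enumerations-length members-enumerates (record
        { unique = spanList-unique xs ixs
        ; sound = s⇒V ∘ spanList-sound xs ; complete = spanList-complete xs ∘ V⇒s }))
      (spanList-length xs)

    module _ d (size : length members ≡ q ^ d) where

      -- The span of d independent vectors already has q^d elements, which leaves no room in `V` for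
      -- an extension.
      independent⇒basis : ∀ {xs} → length xs ≡ d → Independent xs → (∀ {v} → Span xs v → v ∈S V) → Basis V xs
      independent⇒basis {xs} refl ixs s⇒V = ixs , s⇒V , λ {v} v∈V → spans v v∈V (span? xs v)
        where
        no-extension : length (extensions xs) ≡ 0
        no-extension = ℕₚ.+-cancelʳ-≡ (q ^ length xs) (length (extensions xs)) 0
          (≡-trans (extensions-length xs ixs (within-span xs s⇒V)) size)
        spans : ∀ v → v ∈S V → Dec (Span xs v) → Span xs v
        spans v v∈V (yes sv) = sv
        spans v v∈V (no ¬sv) = contradiction no-extension (ℕₚ.n>0⇒n≢0 (∈-length (∈-extensions⁺ xs v∈V ¬sv)))

      basis-length : ∀ {xs} → Basis V xs → length xs ≡ d
      basis-length bxs = q^-injective (≡-trans (sym (basis-size bxs)) size)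

      bases-enumerate : independentLists d Enumerates Basis V
      bases-enumerate = record
        { unique = unique (independentLists-enumerates d)
        ; sound = λ {xs} xs∈ → case′ (sound (independentLists-enumerates d) xs∈)
        ; complete = λ {xs} b@(ixs , s⇒V , _) →
            complete (independentLists-enumerates d) (basis-length b , ixs , within-span xs s⇒V) }
        where
        case′ : ∀ {xs} → length xs ≡ d × Independent xs × All (_∈S V) xs → Basis V xs
        case′ {xs} (len , ixs , within) = independent⇒basis len ixs (span-within xs within)

      bases-length : length (independentLists d) ≡ γ q d
      bases-length = ≡-trans (independentLists-length d)
        (cong (λ m → prodℕ d (λ i → m ∸ q ^ i)) size)

  full-size : ∀ n → length (members (full n)) ≡ q ^ n
  full-size n = ≡-trans (enumerations-length (members-enumerates (full n)) (record
    { unique = unique (allVecs-enumerates n) ; sound = λ _ → refl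
    ; complete = λ _ → complete (allVecs-enumerates n) tt })) (allVecs-length n)

  -- Agreement with `LinIndep` and `HasDim`

  linComb⇒span : ∀ {n d} (bs : Vec (Vect n) d) cs → Span (toList bs) (linComb cs bs)
  linComb⇒span []       []       = refl
  linComb⇒span (b ∷ bs) (c ∷ cs) = c , linComb cs bs , linComb⇒span bs cs , refl

  span⇒linComb : ∀ {n d} (bs : Vec (Vect n) d) {v} → Span (toList bs) v → ∃[ cs ] linComb cs bs ≡ v
  span⇒linComb []       refl = [] , refl
  span⇒linComb (b ∷ bs) (c , u , su , refl) with span⇒linComb bs su
  ... | cs , refl = c ∷ cs , refl

  independent⇒linIndep : ∀ {n d} (bs : Vec (Vect n) d) → Independent (toList bs) → LinIndep bs
  independent⇒linIndep []       _           []       _  = refl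
  independent⇒linIndep (b ∷ bs) (¬sb , ibs) (c ∷ cs) eq =
    cong₂ _∷_ c≡0 (independent⇒linIndep bs ibs cs rest)
    where
    c≡0 : c ≡ 0#
    c≡0 = coefficient-unique (toList bs) ¬sb (linComb⇒span bs cs) (span-0 (toList bs))
      (≡-trans eq (sym (≡-trans (cong (_+V 0V) (·V-zeroˡ b)) (+V-identityˡ 0V))))
    rest : linComb cs bs ≡ 0V
    rest = ≡-trans (sym (+V-identityˡ _)) (≡-trans (cong (_+V linComb cs bs) (sym (≡-trans (cong (_·V b) c≡0) (·V-zeroˡ b)))) eq)

  linIndep⇒independent : ∀ {n d} (bs : Vec (Vect n) d) → LinIndep bs → Independent (toList bs)
  linIndep⇒independent []       _  = tt
  linIndep⇒independent (b ∷ bs) li = ¬sb , linIndep⇒independent bs li′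
    where
    li′ : LinIndep bs
    li′ cs eq = Vecₚ.∷-injectiveʳ (li (0# ∷ cs)
      (≡-trans (cong₂ _+V_ (·V-zeroˡ b) eq) (+V-identityˡ 0V)))
    ¬sb : ¬ Span (toList bs) b
    -- If b is in the span, so is -b; with -b written as the combination `cs`, the relation 1 b +
    -- (-b) = 0 has leading coefficient 1.
    ¬sb sb with span⇒linComb bs (subst (Span (toList bs)) (-V≡-1· b) (subst (Span (toList bs)) (+V-identityˡ (-V b)) (span-- (toList bs) (span-0 (toList bs)) sb)))
    ... | cs , eq = 0≢1 (sym (Vecₚ.∷-injectiveˡ (li (1# ∷ cs)
      (≡-trans (cong₂ _+V_ (·V-identity b) (≡-trans eq (sym (-V≡-1· b)))) (-V-inverseʳ b)))))

  hasDim⇒basis : ∀ {n} {V : Subspace n} {d} → HasDim V d → ∃[ xs ] (length xs ≡ d × Basis V xs)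
  hasDim⇒basis {V = V} (bs , li , within , spans) =
    toList bs , Vecₚ.length-toList bs , linIndep⇒independent bs li
    , span-within V (toList bs) (all-within bs within)
    , λ v∈V → subst (Span (toList bs)) (proj₂ (spans _ v∈V)) (linComb⇒span bs (proj₁ (spans _ v∈V)))
    where
    all-within : ∀ {d} (bs : Vec _ d) → (∀ i → lookup bs i ∈S V) → All (_∈S V) (toList bs)
    all-within []       h = []
    all-within (b ∷ bs) h = h 0F ∷ all-within bs (h ∘ Fin.suc)

  basis⇒hasDim : ∀ {n} {V : Subspace n} {xs} → Basis V xs → HasDim V (length xs)
  basis⇒hasDim {V = V} {xs} (ixs , s⇒V , V⇒s) =
    bs , independent⇒linIndep bs (subst Independent (sym eq) ixs)
    , lookup-within xs (within-span V xs s⇒V)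
    , λ v v∈V → span⇒linComb bs (subst (λ zs → Span zs v) (sym eq) (V⇒s v∈V))
    where
    bs = fromList xs
    eq = Vecₚ.toList∘fromList xs
    lookup-within : ∀ zs → All (_∈S V) zs → ∀ i → lookup (fromList zs) i ∈S V
    lookup-within (z ∷ zs) (z∈ ∷ _)   0F          = z∈
    lookup-within (z ∷ zs) (_ ∷ zs∈) (Fin.suc i) = lookup-within zs zs∈ i

  hasDim⇒size : ∀ {n} {V : Subspace n} {d} → HasDim V d → length (members V) ≡ q ^ d
  hasDim⇒size {V = V} hd with hasDim⇒basis {V = V} hd
  ... | xs , refl , b = basis-size V b

-- Cutting lists into labelled blocks

splits : List A → List (List A × List A)
splits []       = [ [] , [] ]
splits (x ∷ xs) = ([] , x ∷ xs) ∷ map (λ (ys , zs) → x ∷ ys , zs) (splits xs)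

splits-sound : ∀ (xs : List A) {ys zs} → (ys , zs) ∈ splits xs → ys ++ zs ≡ xs
splits-sound []       (here refl) = refl
splits-sound (x ∷ xs) (here refl) = refl
splits-sound (x ∷ xs) (there s∈) with ∈-map⁻ _ s∈
... | _ , s∈′ , refl = cong (x ∷_) (splits-sound xs s∈′)

splits-complete : ∀ (ys zs : List A) → (ys , zs) ∈ splits (ys ++ zs)
splits-complete []       []       = here refl
splits-complete []       (z ∷ zs) = here refl
splits-complete (y ∷ ys) zs       = there (∈-map⁺ (λ (ys , zs) → y ∷ ys , zs) (splits-complete ys zs))

splits-unique : ∀ (xs : List A) → Unique (splits xs)
splits-unique []       = [] ∷ []
splits-unique (x ∷ xs) = All.tabulate (λ { s∈ refl → case (∈-map⁻ _ s∈) })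
                       ∷ Uniqueₚ.map⁺ (λ { refl → refl }) (splits-unique xs)
  where
  case : ¬ (∃[ s ] (s ∈ splits xs × ([] , x ∷ xs) ≡ (x ∷ proj₁ s , proj₂ s)))
  case (_ , _ , ())

-- For each i from 0 to the length of `xs`, exactly one split has a first part of length i; this
-- turns cutting a list into a Cauchy product.
sumOver-splits : ∀ (g : ℕ → ℕ → ℚ) (xs : List A) →
  sumOver (λ (ys , zs) → g (length ys) (length zs)) (splits xs) ≡ sumℚ (suc (length xs)) (λ i → g i (length xs ∸ i))
sumOver-splits g []       = ℚₚ.+-comm (g 0 0) 0ℚ
sumOver-splits g (x ∷ xs) = ≡-trans
  (cong (g 0 (suc (length xs)) +ℚ_) (≡-trans (sumOver-map _ _ (splits xs)) (sumOver-splits (g ∘ suc) xs)))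
  (sym (sumℚ-head (suc (length xs)) (λ i → g i (suc (length xs) ∸ i))))

module Blocks {X P : Set} (𝓕 : QExpFamily P) where
  open QExpFamily 𝓕

  Block : Set
  Block = List X × P

  -- The first block comes last, in step with powS (suc k) = powS k ⊛ S.
  flatten : ∀ {k} → Vec Block k → List X
  flatten []             = []
  flatten ((xs , _) ∷ bs) = flatten bs ++ xs

  InDeck : Block → Set
  InDeck (xs , p) = p ∈ deck (length xs)

  labelings : ∀ {k} → List X → Vec Block k → List (Vec Block (suc k))
  labelings xs bs = map (λ p → (xs , p) ∷ bs) (deck (length xs))

  cuts : ∀ k → List X → List (Vec Block k)
  splitCuts : ∀ k → List X × List X → List (Vec Block (suc k))

  cuts zero    []      = [ [] ]
  -- No blocks cannot cover a nonempty list; the matching fact for series is that `oneS` vanishes at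
  -- x^n for n > 0.
  cuts zero    (_ ∷ _) = []
  cuts (suc k) xs      = concatMap (splitCuts k) (splits xs)

  splitCuts k (ys , zs) = concatMap (labelings zs) (cuts k ys)

  ∈-labelings⁻ : ∀ {k} xs (bs : Vec Block k) {cs} → cs ∈ labelings xs bs →
                 ∃[ p ] (InDeck (xs , p) × cs ≡ (xs , p) ∷ bs)
  ∈-labelings⁻ xs bs cs∈ = ∈-map⁻ (λ p → (xs , p) ∷ bs) cs∈

  ∈-splitCuts⁻ : ∀ k ys zs {cs} → cs ∈ splitCuts k (ys , zs) →
                 ∃[ p ] ∃[ bs ] (bs ∈ cuts k ys × InDeck (zs , p) × cs ≡ (zs , p) ∷ bs)
  ∈-splitCuts⁻ k ys zs cs∈ with ∈-concatMap⁻′ (labelings zs) (cuts k ys) cs∈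
  ... | bs , bs∈ , cs∈′ with ∈-labelings⁻ zs bs cs∈′
  ...   | p , p∈ , eq = p , bs , bs∈ , p∈ , eq

  cuts-sound : ∀ k xs {bs} → bs ∈ cuts k xs → flatten bs ≡ xs × VecAll InDeck bs
  cuts-sound zero    []       (here refl) = refl , []
  cuts-sound (suc k) xs bs∈ with ∈-concatMap⁻′ (splitCuts k) (splits xs) bs∈
  ... | (ys , zs) , s∈ , cs∈ with ∈-splitCuts⁻ k ys zs cs∈
  ...   | p , bs , bs∈′ , p∈ , refl with cuts-sound k ys bs∈′
  ...     | refl , ps = splits-sound xs s∈ , p∈ ∷ ps

  cuts-complete : ∀ {k} (bs : Vec Block k) → VecAll InDeck bs → bs ∈ cuts k (flatten bs)
  cuts-complete []              []        = here refl
  cuts-complete {suc k} ((xs , p) ∷ bs) (p∈ ∷ ps) =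
    ∈-concatMap⁺′ (splitCuts k) (splits-complete (flatten bs) xs)
      (∈-concatMap⁺′ (labelings xs) (cuts-complete bs ps) (∈-map⁺ (λ p → (xs , p) ∷ bs) p∈))

  cuts-unique : ∀ k xs → Unique (cuts k xs)
  cuts-unique zero    []      = [] ∷ []
  cuts-unique zero    (_ ∷ _) = []
  cuts-unique (suc k) xs      = unique-concatMap (splitCuts k) (splits-unique xs)
    (λ {(ys , zs)} _ → unique-concatMap (labelings zs) (cuts-unique k ys)
      (λ _ → Uniqueₚ.map⁺ (λ { refl → refl }) (deck-pic (length zs))) same-tail)
    λ {s} {s′} → same-split {s} {s′}
    where
    same-tail : ∀ {zs} {bs bs′ : Vec Block k} {cs} → cs ∈ labelings zs bs → cs ∈ labelings zs bs′ → bs ≡ bs′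
    same-tail {zs} {bs} {bs′} cs∈ cs∈′ with ∈-labelings⁻ zs bs cs∈ | ∈-labelings⁻ zs bs′ cs∈′
    ... | _ , _ , refl | _ , _ , refl = refl
    same-split : ∀ {s s′ cs} → cs ∈ splitCuts k s → cs ∈ splitCuts k s′ → s ≡ s′
    same-split {ys , zs} {ys′ , zs′} cs∈ cs∈′ with ∈-splitCuts⁻ k ys zs cs∈ | ∈-splitCuts⁻ k ys′ zs′ cs∈′
    ... | _ , bs , bs∈ , _ , refl | _ , _ , bs∈′ , _ , refl with cuts-sound k ys bs∈ | cuts-sound k ys′ bs∈′
    ...   | refl , _ | refl , _ = refl

  -- Weights of cuts

  module _ (𝔽 : FiniteField) where
    open FiniteField 𝔽 using (q)
    open Enumerators 𝔽 𝓕

    weight : ∀ {k} → Vec Block k → ℚ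
    weight []              = 1ℚ
    weight ((xs , _) ∷ bs) = weight bs *ℚ (1 // γ q (length xs))

    yDeckEnum-linear : ∀ n {j} → j ≢ 1 → yDeckEnum n j ≡ 0ℚ
    yDeckEnum-linear n {zero}        j≢1 = refl
    yDeckEnum-linear n {suc zero}    j≢1 = contradiction refl j≢1
    yDeckEnum-linear n {suc (suc j)} j≢1 = refl

    -- All d_n pictures give the same weight, so together they contribute the coefficient d_n / γ_n
    -- of the deck enumerator.
    labelings-weight : ∀ {k} xs (bs : Vec Block k) →
      sumOver weight (labelings xs bs) ≡ weight bs *ℚ yDeckEnum (length xs) 1
    labelings-weight xs bs = begin
      sumOver weight (labelings xs bs)                ≡⟨ sumOver-map weight (λ p → (xs , p) ∷ bs) (deck n) ⟩
      sumOver (λ _ → weight bs *ℚ (1 // γ q n)) (deck n)  ≡⟨ sumOver-const (weight bs *ℚ (1 // γ q n)) (deck n) ⟩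
      (d n // 1) *ℚ (weight bs *ℚ (1 // γ q n))       ≡⟨ ℚₚ.*-assoc (d n // 1) (weight bs) _ ⟨
      ((d n // 1) *ℚ weight bs) *ℚ (1 // γ q n)       ≡⟨ cong (_*ℚ (1 // γ q n)) (ℚₚ.*-comm (d n // 1) (weight bs)) ⟩
      (weight bs *ℚ (d n // 1)) *ℚ (1 // γ q n)       ≡⟨ ℚₚ.*-assoc (weight bs) (d n // 1) _ ⟩
      weight bs *ℚ ((d n // 1) *ℚ (1 // γ q n))       ≡⟨ cong (weight bs *ℚ_) (//-as-product (d n) (γ q n)) ⟨
      weight bs *ℚ (d n // γ q n)                     ∎
      where
      open ≡-Reasoning
      n = length xs

    -- Only the length of `xs` matters, so all bases of E_n contribute equally. The recursion on k
    -- is multiplication by one more deck series: the final stretch `zs` of a split is the head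
    -- block.
    cuts-weight : ∀ k xs → sumOver weight (cuts k xs) ≡ powS yDeckEnum k (length xs) k
    cuts-weight zero    []      = ℚₚ.+-identityʳ 1ℚ
    cuts-weight zero    (_ ∷ _) = refl
    cuts-weight (suc k) xs      = begin
      sumOver weight (cuts (suc k) xs)
        ≡⟨ sumOver-concatMap weight (splitCuts k) (splits xs) ⟩
      sumOver (λ s → sumOver weight (splitCuts k s)) (splits xs)
        ≡⟨ sumOver-cong (splits xs) (λ {s} _ → step s) ⟩
      sumOver (λ (ys , zs) → powS yDeckEnum k (length ys) k *ℚ yDeckEnum (length zs) 1) (splits xs)
        ≡⟨ sumOver-splits (λ a b → powS yDeckEnum k a k *ℚ yDeckEnum b 1) xs ⟩
      sumℚ (suc (length xs)) (λ i → powS yDeckEnum k i k *ℚ yDeckEnum (length xs ∸ i) 1)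
        ≡⟨ powS-diagonal yDeckEnum yDeckEnum-linear k (length xs) ⟨
      powS yDeckEnum (suc k) (length xs) (suc k) ∎
      where
      open ≡-Reasoning
      step : ∀ ((ys , zs) : List X × List X) → sumOver weight (splitCuts k (ys , zs)) ≡
             powS yDeckEnum k (length ys) k *ℚ yDeckEnum (length zs) 1
      step (ys , zs) = begin
        sumOver weight (splitCuts k (ys , zs))
          ≡⟨ sumOver-concatMap weight (labelings zs) (cuts k ys) ⟩
        sumOver (λ bs → sumOver weight (labelings zs bs)) (cuts k ys)
          ≡⟨ sumOver-cong (cuts k ys) (λ {bs} _ → labelings-weight zs bs) ⟩
        sumOver (λ bs → weight bs *ℚ yDeckEnum (length zs) 1) (cuts k ys)
          ≡⟨ sumOver-*ʳ weight (yDeckEnum (length zs) 1) (cuts k ys) ⟩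
        sumOver weight (cuts k ys) *ℚ yDeckEnum (length zs) 1
          ≡⟨ cong (_*ℚ yDeckEnum (length zs) 1) (cuts-weight k ys) ⟩
        powS yDeckEnum k (length ys) k *ℚ yDeckEnum (length zs) 1 ∎

-- Framed hands

module Framing (𝔽 : FiniteField) {P : Set} (𝓕 : QExpFamily P) (n : ℕ) where
  open FiniteField 𝔽 using (q)
  open LinAlg 𝔽
  open LinearAlgebra 𝔽
  open QExpFamily 𝓕
  open Hands 𝔽 𝓕
  open Blocks {Vect n} 𝓕

  -- Direct sums and independence of concatenated blocks

  block-span : ∀ {k} → Vec Block k → Fin k → Vect n → Set
  block-span bs i = Span (proj₁ (lookup bs i))

  sum-in-flatten : ∀ {k} (bs : Vec Block k) w → (∀ i → block-span bs i (w i)) → Span (flatten bs) (sumFin k w)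
  sum-in-flatten []              w w∈ = refl
  -- `sumFin` starts with the vector of the head block while `flatten` ends with that block;
  -- commutativity reconciles the orders.
  sum-in-flatten ((xs , _) ∷ bs) w w∈ = subst (Span (flatten bs ++ xs)) (+V-comm _ (w 0F))
    (span-++⁺ (flatten bs) xs (sum-in-flatten bs (w ∘ Fin.suc) (w∈ ∘ Fin.suc)) (w∈ 0F))

  sumFin-0 : ∀ k → sumFin {n} k (λ _ → 0V) ≡ 0V
  sumFin-0 zero    = refl
  sumFin-0 (suc k) = ≡-trans (+V-identityˡ _) (sumFin-0 k)

  cons : ∀ {k} → Vect n → (Fin k → Vect n) → Fin (suc k) → Vect n
  cons v w 0F          = v
  cons v w (Fin.suc i) = w i

  cons-in : ∀ {k} (bs : Vec Block (suc k)) {v w} → Span (proj₁ (Vec.head bs)) v →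
            (∀ i → block-span (Vec.tail bs) i (w i)) → ∀ i → block-span bs i (cons v w i)
  cons-in (_ ∷ _) v∈ w∈ 0F          = v∈
  cons-in (_ ∷ _) v∈ w∈ (Fin.suc i) = w∈ i

  flatten-decompose : ∀ {k} (bs : Vec Block k) {v} → Span (flatten bs) v →
                      ∃[ w ] ((∀ i → block-span bs i (w i)) × sumFin k w ≡ v)
  flatten-decompose []                           refl = (λ ()) , (λ ()) , refl
  flatten-decompose {suc k} bs⁺@((xs , _) ∷ bs) sv with span-++⁻ (flatten bs) xs sv
  ... | u , t , su , st , refl with flatten-decompose bs su
  ...   | w , w∈ , refl = cons t w , cons-in bs⁺ st w∈ , +V-comm t (sumFin k w)

  -- The uniqueness half of `IsDirectSumDecomp`, transferred from label spaces to spans of blocks.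
  UniqueSums : ∀ {k} → Vec Block k → Set
  UniqueSums {k} bs = ∀ (w w′ : Fin k → Vect n) → (∀ i → block-span bs i (w i)) → (∀ i → block-span bs i (w′ i)) →
                      sumFin k w ≡ sumFin k w′ → ∀ i → w i ≡ w′ i

  -- The difference of the two head components is also a difference of sums of the other components,
  -- so it lies in two spans that meet only in 0.
  independent⇒uniqueSums : ∀ {k} (bs : Vec Block k) → Independent (flatten bs) → UniqueSums bs
  independent⇒uniqueSums {suc k} ((xs , _) ∷ bs) ind w w′ w∈ w′∈ eq = same
    where
    parts = independent-++⁻ (flatten bs) xs ind
    transposed : w 0F -V w′ 0F ≡ sumFin k (w′ ∘ Fin.suc) -V sumFin k (w ∘ Fin.suc)
    transposed = +V-transpose (w 0F) _ (w′ 0F) _ eq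
    heads : w 0F ≡ w′ 0F
    heads = -V≡0⇒≡ _ _ (proj₂ (proj₂ parts)
      (subst (Span (flatten bs)) (sym transposed) (span-- (flatten bs)
        (sum-in-flatten bs (w′ ∘ Fin.suc) (w′∈ ∘ Fin.suc)) (sum-in-flatten bs (w ∘ Fin.suc) (w∈ ∘ Fin.suc))))
      (span-- xs (w∈ 0F) (w′∈ 0F)))
    same : ∀ i → w i ≡ w′ i
    same 0F          = heads
    same (Fin.suc i) = independent⇒uniqueSums bs (proj₁ parts) (w ∘ Fin.suc) (w′ ∘ Fin.suc)
      (w∈ ∘ Fin.suc) (w′∈ ∘ Fin.suc) (+V-cancelˡ (w 0F) _ _ (≡-trans eq (cong (_+V _) (sym heads)))) i

  uniqueSums⇒independent : ∀ {k} (bs : Vec Block k) → (∀ i → Independent (proj₁ (lookup bs i))) →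
                           UniqueSums bs → Independent (flatten bs)
  uniqueSums⇒independent []              _    _ = tt
  uniqueSums⇒independent {suc k} bs⁺@((xs , _) ∷ bs) inds u =
    independent-++⁺ (flatten bs) xs (uniqueSums⇒independent bs (inds ∘ Fin.suc) tails) (inds 0F) disjoint
    where
    tails : UniqueSums bs
    tails w w′ w∈ w′∈ eq i = u (cons 0V w) (cons 0V w′) (cons-in bs⁺ (span-0 xs) w∈) (cons-in bs⁺ (span-0 xs) w′∈)
      (cong (0V +V_) eq) (Fin.suc i)
    disjoint : Disjoint (flatten bs) xs
    -- Such a v has two decompositions: v in the head block and 0 elsewhere, or 0 in the head block
    -- and `w` elsewhere.
    disjoint {v} sv sv′ with flatten-decompose bs sv
    ... | w , w∈ , eq = u (cons v (λ _ → 0V)) (cons 0V w)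
      (cons-in bs⁺ sv′ (λ i → span-0 (proj₁ (lookup bs i)))) (cons-in bs⁺ (span-0 xs) w∈)
      (≡-trans (cong (v +V_) (sumFin-0 k)) (≡-trans (+V-comm v 0V) (cong (0V +V_) (sym eq)))) 0F

  -- Blocks framing cards and hands

  Frames : Block → Card n → Set
  Frames (xs , p) c = Basis (space c) xs × p ≡ pic c

  FramesHand : ∀ {k} → Vec Block k → (Fin k → Card n) → Set
  FramesHand bs cs = ∀ i → Frames (lookup bs i) (cs i)

  -- Both label spaces are the span of the same block. Hence a frame determines its cards, which
  -- keeps the frames of different hands apart.
  frame-≈C : ∀ {b c c′} → Frames b c → Frames b c′ → c ≈C c′
  frame-≈C {b} {c} {c′} ((_ , s⇒V , V⇒s) , refl) ((_ , s⇒V′ , V′⇒s) , refl) = same , refl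
    where
    same : ∀ v → mem (space c) v ≡ mem (space c′) v
    same v with mem (space c) v in eq | mem (space c′) v in eq′
    ... | true  | true  = refl
    ... | false | false = refl
    ... | true  | false = ≡-trans (sym (s⇒V′ (V⇒s eq))) eq′
    ... | false | true  = ≡-trans (sym eq) (s⇒V (V′⇒s eq′))

  frames-resp : ∀ {b c c′} → c ≈C c′ → Frames b c → Frames b c′
  frames-resp (V≈V′ , refl) ((ixs , s⇒V , V⇒s) , p≡) =
    (ixs , (λ {v} sv → ≡-trans (sym (V≈V′ v)) (s⇒V sv)) , λ {v} v∈ → V⇒s (≡-trans (V≈V′ v) v∈)) , p≡

  card-size : ∀ (c : Card n) → length (members (space c)) ≡ q ^ dim c
  card-size c = hasDim⇒size {V = space c} (hasDim c)

  -- `inDeck` refers to the dimension recorded in the card, `InDeck` to the number of vectors in the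
  -- block; they agree because all bases have the same length.
  frame-inDeck : ∀ {b c} → Frames b c → InDeck b
  frame-inDeck {xs , _} {c} (bxs , refl) =
    subst (λ m → pic c ∈ deck m) (sym (basis-length (space c) (dim c) (card-size c) bxs)) (inDeck c)

  -- The framed hands described without cards: the predicate on which the two enumerations meet.
  Good : ∀ {k} → Vec Block k → Set
  Good bs = Basis (full n) (flatten bs) × VecAll InDeck bs

  framed⇒good : ∀ {k} (H : Hand n k) bs → FramesHand bs (cards H) → Good bs
  framed⇒good {k} H bs fr = (ind , (λ _ → refl) , λ {v} _ → spans v) , all bs (cards H) fr
    where
    all : ∀ {k} (bs : Vec Block k) cs → FramesHand bs cs → VecAll InDeck bs
    all []       cs fr = []
    all (b ∷ bs) cs fr = frame-inDeck {b} {cs 0F} (fr 0F) ∷ all bs (cs ∘ Fin.suc) (fr ∘ Fin.suc)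
    ind : Independent (flatten bs)
    ind = uniqueSums⇒independent bs (λ i → proj₁ (proj₁ (fr i)))
      λ w w′ w∈ w′∈ → proj₂ (direct H) w w′
        (λ i → proj₁ (proj₂ (proj₁ (fr i))) (w∈ i)) (λ i → proj₁ (proj₂ (proj₁ (fr i))) (w′∈ i))
    spans : ∀ v → Span (flatten bs) v
    spans v with proj₁ (direct H) v
    ... | w , w∈ , refl = sum-in-flatten bs w (λ i → proj₂ (proj₂ (proj₁ (fr i))) (w∈ i))

  spanSubspace : List (Vect n) → Subspace n
  spanSubspace xs = record
    { mem = λ v → does (span? xs v)
    ; mem-0 = dec-true (span? xs _) (span-0 xs)
    ; mem-+ = λ u v u∈ v∈ → dec-true (span? xs _) (span-+ xs (does⁻ (span? xs u) u∈) (does⁻ (span? xs v) v∈))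
    ; mem-scale = λ a v v∈ → dec-true (span? xs _) (span-scale xs a (does⁻ (span? xs v) v∈)) }

  spanSubspace-basis : ∀ {xs} → Independent xs → Basis (spanSubspace xs) xs
  spanSubspace-basis {xs} ixs = ixs , (λ {v} → dec-true (span? xs v)) , λ {v} → does⁻ (span? xs v)

  blocks-independent : ∀ {k} (bs : Vec Block k) → Independent (flatten bs) → ∀ i → Independent (proj₁ (lookup bs i))
  blocks-independent ((xs , _) ∷ bs) ind 0F          = proj₁ (proj₂ (independent-++⁻ (flatten bs) xs ind))
  blocks-independent ((xs , _) ∷ bs) ind (Fin.suc i) =
    blocks-independent bs (proj₁ (independent-++⁻ (flatten bs) xs ind)) i

  -- The spans of the blocks serve as label spaces; independence of the whole list makes
  -- decompositions unique, and its spanning makes them exist.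
  good⇒framed : ∀ {k} (bs : Vec Block k) → Good bs → ∃[ H ] FramesHand {k} bs (cards H)
  good⇒framed {k} bs ((ind , _ , spans) , ps) =
    record { cards = card
           ; direct = (λ v → decompose v) , λ w w′ w∈ w′∈ → independent⇒uniqueSums bs ind w w′
               (λ i → does⁻ (span? (vectors i) (w i)) (w∈ i)) (λ i → does⁻ (span? (vectors i) (w′ i)) (w′∈ i)) }
    , λ i → basis i , refl
    where
    vectors : Fin k → List (Vect n)
    vectors i = proj₁ (lookup bs i)
    basis : ∀ i → Basis (spanSubspace (vectors i)) (vectors i)
    basis i = spanSubspace-basis (blocks-independent bs ind i)
    lookup-inDeck : ∀ {k} {bs : Vec Block k} → VecAll InDeck bs → ∀ i → InDeck (lookup bs i)
    lookup-inDeck (p ∷ _)  0F          = p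
    lookup-inDeck (_ ∷ ps) (Fin.suc i) = lookup-inDeck ps i
    card : Fin k → Card n
    card i = record
      { space = spanSubspace (vectors i) ; dim = length (vectors i)
      ; hasDim = basis⇒hasDim {V = spanSubspace (vectors i)} (basis i)
      ; pic = proj₂ (lookup bs i) ; inDeck = lookup-inDeck ps i }
    decompose : ∀ v → ∃[ w ] ((∀ i → w i ∈S space (card i)) × sumFin k w ≡ v)
    decompose v with flatten-decompose bs (spans {v} refl)
    ... | w , w∈ , eq = w , (λ i → dec-true (span? (vectors i) (w i)) (w∈ i)) , eq

  -- Framed hands as cut bases of E_n

  goodList : ∀ k → List (Vec Block k)
  goodList k = concatMap (cuts k) (independentLists (full n) n)

  goodList-enumerates : ∀ k → goodList k Enumerates Good
  goodList-enumerates k = record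
    { unique = unique-concatMap (cuts k) (unique bases) (λ {xs} _ → cuts-unique k xs)
        (λ {xs} {xs′} c∈ c∈′ → ≡-trans (sym (proj₁ (cuts-sound k xs c∈))) (proj₁ (cuts-sound k xs′ c∈′)))
    ; sound = λ bs∈ → sound′ bs∈
    ; complete = λ {bs} (b , ps) → ∈-concatMap⁺′ (cuts k) (complete bases b) (cuts-complete bs ps) }
    where
    bases = bases-enumerate (full n) n (full-size n)
    sound′ : ∀ {bs} → bs ∈ goodList k → Good bs
    sound′ bs∈ with ∈-concatMap⁻′ (cuts k) (independentLists (full n) n) bs∈
    ... | xs , xs∈ , bs∈′ with cuts-sound k xs bs∈′
    ...   | refl , ps = sound bases xs∈ , ps

  goodList-weight : ∀ k → sumOver (weight 𝔽) (goodList k) ≡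
                    (γ q n // 1) *ℚ powS (Enumerators.yDeckEnum 𝔽 𝓕) k n k
  goodList-weight k = begin
    sumOver (weight 𝔽) (goodList k)
      ≡⟨ sumOver-concatMap (weight 𝔽) (cuts k) matrices ⟩
    sumOver (λ xs → sumOver (weight 𝔽) (cuts k xs)) matrices
      ≡⟨ sumOver-cong matrices (λ {xs} xs∈ → ≡-trans (cuts-weight 𝔽 k xs)
           (cong (λ m → powS (Enumerators.yDeckEnum 𝔽 𝓕) k m k)
             (proj₁ (sound (independentLists-enumerates (full n) n) xs∈)))) ⟩
    sumOver (λ _ → W) matrices
      ≡⟨ sumOver-const W matrices ⟩
    (length matrices // 1) *ℚ W
      ≡⟨ cong (λ m → (m // 1) *ℚ W) (bases-length (full n) n (full-size n)) ⟩
    (γ q n // 1) *ℚ W ∎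
    where
    open ≡-Reasoning
    matrices = independentLists (full n) n
    W = powS (Enumerators.yDeckEnum 𝔽 𝓕) k n k

  -- Frames of a given ordered hand

  cardFrames : Card n → List Block
  cardFrames c = map (_, pic c) (independentLists (space c) (dim c))

  frames : ∀ k → (Fin k → Card n) → List (Vec Block k)
  consFrames : ∀ k → (Fin (suc k) → Card n) → Block → List (Vec Block (suc k))

  frames zero    cs = [ [] ]
  frames (suc k) cs = concatMap (consFrames k cs) (cardFrames (cs 0F))

  consFrames k cs b = map (b ∷_) (frames k (cs ∘ Fin.suc))

  cardFrames-enumerates : ∀ c → cardFrames c Enumerates (λ b → Frames b c)
  cardFrames-enumerates c = record
    { unique = Uniqueₚ.map⁺ (λ { refl → refl }) (unique bases)
    ; sound = λ b∈ → sound′ (∈-map⁻ (_, pic c) b∈)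
    ; complete = λ { (b , refl) → ∈-map⁺ (_, pic c) (complete bases b) } }
    where
    bases = bases-enumerate (space c) (dim c) (card-size c)
    sound′ : ∀ {b} → ∃[ xs ] (xs ∈ independentLists (space c) (dim c) × b ≡ (xs , pic c)) → Frames b c
    sound′ (xs , xs∈ , refl) = sound bases xs∈ , refl

  frames-enumerates : ∀ k cs → frames k cs Enumerates (λ bs → FramesHand bs cs)
  frames-enumerates zero    cs = record
    { unique = [] ∷ [] ; sound = λ _ () ; complete = λ { {[]} _ → here refl } }
  frames-enumerates (suc k) cs = record
    { unique = unique-concatMap (consFrames k cs) (unique firsts) (λ _ → Uniqueₚ.map⁺ Vecₚ.∷-injectiveʳ (unique rests)) same-head
    ; sound = λ bs∈ → sound′ bs∈
    ; complete = λ { {b ∷ bs} fr → ∈-concatMap⁺′ (consFrames k cs) (complete firsts (fr 0F))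
        (∈-map⁺ (b ∷_) (complete rests (fr ∘ Fin.suc))) } }
    where
    firsts = cardFrames-enumerates (cs 0F)
    rests = frames-enumerates k (cs ∘ Fin.suc)
    same-head : ∀ {b b′ bs} → bs ∈ consFrames k cs b → bs ∈ consFrames k cs b′ → b ≡ b′
    same-head {b} {b′} bs∈ bs∈′ with ∈-map⁻ (b ∷_) bs∈ | ∈-map⁻ (b′ ∷_) bs∈′
    ... | _ , _ , refl | _ , _ , refl = refl
    sound′ : ∀ {bs} → bs ∈ frames (suc k) cs → FramesHand bs cs
    sound′ bs∈ with ∈-concatMap⁻′ (consFrames k cs) (cardFrames (cs 0F)) bs∈
    ... | b , b∈ , bs∈′ with ∈-map⁻ (b ∷_) bs∈′
    ...   | bs , bs∈″ , refl = λ { 0F → sound firsts b∈ ; (Fin.suc i) → sound rests bs∈″ i }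

  frames-weight : ∀ k cs → sumOver (weight 𝔽) (frames k cs) ≡ 1ℚ
  frames-weight zero    cs = ℚₚ.+-identityʳ 1ℚ
  frames-weight (suc k) cs = begin
    sumOver (weight 𝔽) (frames (suc k) cs)
      ≡⟨ sumOver-concatMap (weight 𝔽) (consFrames k cs) (cardFrames (cs 0F)) ⟩
    sumOver (λ b → sumOver (weight 𝔽) (consFrames k cs b)) (cardFrames (cs 0F))
      ≡⟨ sumOver-map _ (_, pic (cs 0F)) bases ⟩
    sumOver (λ xs → sumOver (weight 𝔽) (consFrames k cs (xs , pic (cs 0F)))) bases
      ≡⟨ sumOver-cong bases (λ {xs} xs∈ → step xs xs∈) ⟩
    sumOver (λ _ → 1 // γ q m) bases
      ≡⟨ sumOver-const (1 // γ q m) bases ⟩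
    (length bases // 1) *ℚ (1 // γ q m)
      ≡⟨ cong (λ l → (l // 1) *ℚ (1 // γ q m)) (bases-length (space (cs 0F)) m (card-size (cs 0F))) ⟩
    (γ q m // 1) *ℚ (1 // γ q m)
      -- The cancellation requires γ ≠ 0, since `//` returns 0 on a zero denominator.
      ≡⟨ //1-*-1// (γ q m) (γ-nonzero m) ⟩
    1ℚ ∎
    where
    open ≡-Reasoning
    m = dim (cs 0F)
    bases = independentLists (space (cs 0F)) m
    step : ∀ xs → xs ∈ bases → sumOver (weight 𝔽) (consFrames k cs (xs , pic (cs 0F))) ≡ 1 // γ q m
    step xs xs∈ = begin
      sumOver (weight 𝔽) (consFrames k cs (xs , pic (cs 0F)))
        ≡⟨ sumOver-map (weight 𝔽) ((xs , pic (cs 0F)) ∷_) (frames k (cs ∘ Fin.suc)) ⟩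
      sumOver (λ bs → weight 𝔽 bs *ℚ (1 // γ q (length xs))) (frames k (cs ∘ Fin.suc))
        ≡⟨ sumOver-*ʳ (weight 𝔽) (1 // γ q (length xs)) (frames k (cs ∘ Fin.suc)) ⟩
      sumOver (weight 𝔽) (frames k (cs ∘ Fin.suc)) *ℚ (1 // γ q (length xs))
        ≡⟨ cong (_*ℚ (1 // γ q (length xs))) (frames-weight k (cs ∘ Fin.suc)) ⟩
      1ℚ *ℚ (1 // γ q (length xs))
        ≡⟨ ℚₚ.*-identityˡ (1 // γ q (length xs)) ⟩
      1 // γ q (length xs)
        ≡⟨ cong (λ l → 1 // γ q l) (proj₁ (sound (independentLists-enumerates (space (cs 0F)) m) xs∈)) ⟩
      1 // γ q m ∎

  -- Reordering the cards of a hand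

  private
    module VectSum = CommutativeMonoidSum (AbelianGroup.commutativeMonoid (V-abelianGroup n))

  sumFin≡sum : ∀ k (w : Fin k → Vect n) → sumFin k w ≡ VectSum.sum w
  sumFin≡sum zero    w = refl
  sumFin≡sum (suc k) w = cong (w 0F +V_) (sumFin≡sum k (w ∘ Fin.suc))

  sumFin-permute : ∀ {k} (π : Permutation′ k) (w : Fin k → Vect n) → sumFin k (w ∘ (π ⟨$⟩ʳ_)) ≡ sumFin k w
  sumFin-permute {k} π w = ≡-trans (sumFin≡sum k _)
    (≡-trans (sym (VectSum.sum-permute w π)) (sym (sumFin≡sum k w)))

  directSum-permute : ∀ {k} (π : Permutation′ k) (Vs : Fin k → Subspace n) →
                      IsDirectSumDecomp k Vs → IsDirectSumDecomp k (Vs ∘ (π ⟨$⟩ʳ_))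
  directSum-permute {k} π Vs (spans , uniq) = spans′ , uniq′
    where
    spans′ : ∀ v → ∃[ w ] ((∀ i → w i ∈S Vs (π ⟨$⟩ʳ i)) × sumFin k w ≡ v)
    spans′ v with spans v
    ... | w , w∈ , eq = w ∘ (π ⟨$⟩ʳ_) , (λ i → w∈ (π ⟨$⟩ʳ i)) , ≡-trans (sumFin-permute π w) eq
    unpermuted-∈ : ∀ w → (∀ i → w i ∈S Vs (π ⟨$⟩ʳ i)) → ∀ i → w (π ⟨$⟩ˡ i) ∈S Vs i
    unpermuted-∈ w w∈ i = subst (λ j → w (π ⟨$⟩ˡ i) ∈S Vs j) (Perm.inverseʳ π) (w∈ (π ⟨$⟩ˡ i))
    uniq′ : ∀ w w′ → (∀ i → w i ∈S Vs (π ⟨$⟩ʳ i)) → (∀ i → w′ i ∈S Vs (π ⟨$⟩ʳ i)) →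
            sumFin k w ≡ sumFin k w′ → ∀ i → w i ≡ w′ i
    -- Precomposing with the inverse of π gives families in the original order with unchanged sums;
    -- their agreement at index π i is the one wanted at i.
    uniq′ w w′ w∈ w′∈ eq i = subst (λ j → w j ≡ w′ j) (Perm.inverseˡ π)
      (uniq (w ∘ (π ⟨$⟩ˡ_)) (w′ ∘ (π ⟨$⟩ˡ_)) (unpermuted-∈ w w∈) (unpermuted-∈ w′ w′∈)
        (≡-trans (sumFin-permute (Perm.flip π) w) (≡-trans eq (sym (sumFin-permute (Perm.flip π) w′))))
        (π ⟨$⟩ʳ i))

  permuteHand : ∀ {k} → Hand n k → Permutation′ k → Hand n k
  permuteHand H π = record { cards = cards H ∘ (π ⟨$⟩ʳ_) ; direct = directSum-permute π (λ i → space (cards H i)) (direct H) }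

  -- Distinctness of the cards of a hand

  single : ∀ {k} → Fin k → Vect n → Fin k → Vect n
  single 0F          v 0F          = v
  single 0F          v (Fin.suc j) = 0V
  single (Fin.suc i) v 0F          = 0V
  single (Fin.suc i) v (Fin.suc j) = single i v j

  sumFin-single : ∀ {k} (i : Fin k) v → sumFin k (single i v) ≡ v
  sumFin-single {suc k} 0F          v = ≡-trans (cong (v +V_) (sumFin-0 k)) (+V-identityʳ v)
  sumFin-single         (Fin.suc i) v = ≡-trans (+V-identityˡ _) (sumFin-single i v)

  single-∈ : ∀ {k} (Vs : Fin k → Subspace n) i {v} → v ∈S Vs i → ∀ j → single i v j ∈S Vs j
  single-∈ Vs 0F          v∈ 0F          = v∈
  single-∈ Vs 0F          v∈ (Fin.suc j) = mem-0 (Vs (Fin.suc j))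
  single-∈ Vs (Fin.suc i) v∈ 0F          = mem-0 (Vs 0F)
  single-∈ Vs (Fin.suc i) v∈ (Fin.suc j) = single-∈ (Vs ∘ Fin.suc) i v∈ j

  single-diagonal : ∀ {k} (i : Fin k) v → single i v i ≡ v
  single-diagonal 0F          v = refl
  single-diagonal (Fin.suc i) v = single-diagonal i v

  single-off-diagonal : ∀ {k} (i j : Fin k) v → i ≢ j → single i v j ≡ 0V
  single-off-diagonal 0F          0F          v i≢j = contradiction refl i≢j
  single-off-diagonal 0F          (Fin.suc j) v i≢j = refl
  single-off-diagonal (Fin.suc i) 0F          v i≢j = refl
  single-off-diagonal (Fin.suc i) (Fin.suc j) v i≢j = single-off-diagonal i j v (i≢j ∘ cong Fin.suc)

  -- Since `deck 0` is empty, a basis of a label space is nonempty. A zero label space could occur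
  -- repeatedly in a direct sum.
  card-nontrivial : (c : Card n) → ∃[ v ] (v ∈S space c × v ≢ 0V)
  card-nontrivial c with hasDim⇒basis {V = space c} (hasDim c)
  ... | [] , len , _ = contradiction (subst (pic c ∈_) (≡-trans (cong deck (sym len)) deck-0) (inDeck c)) λ ()
  ... | x ∷ xs , _ , (¬sx , _) , s⇒V , _ =
    x , s⇒V (span-here x xs) , λ x≡0 → ¬sx (subst (Span xs) (sym x≡0) (span-0 xs))

  -- A nonzero v in label spaces with different indices i and j would be the sum of both
  -- `single i v` and `single j v`, against uniqueness. Hence the k! reorderings of a hand are
  -- different ordered hands.
  spaces-distinct : ∀ {k} (H : Hand n k) i j → space (cards H i) ≈S space (cards H j) → i ≡ j
  spaces-distinct H i j V≈ with i Finₚ.≟ j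
  ... | yes i≡j = i≡j
  ... | no i≢j with card-nontrivial (cards H i)
  ...   | v , v∈ , v≢0 = contradiction v≡0 v≢0
    where
    Vs = λ i → space (cards H i)
    v≡0 : v ≡ 0V
    v≡0 = ≡-trans (sym (single-diagonal i v)) (≡-trans
      (proj₂ (direct H) (single i v) (single j v) (single-∈ Vs i v∈)
        (single-∈ Vs j (≡-trans (sym (V≈ v)) v∈)) (≡-trans (sumFin-single i v) (sym (sumFin-single j v))) i)
      (single-off-diagonal j i v (i≢j ∘ sym)))

  -- The double count of framed hands

  module _ {k m} (count : HasCount (Hand n k) _≈H_ m) where

    private
      hand = proj₁ count
      distinct-hands = proj₁ (proj₂ count)
      all-hands = proj₂ (proj₂ count)

    permutedFrames : Fin m → Permutation′ k → List (Vec Block k)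
    permutedFrames i π = frames k (cards (permuteHand (hand i) π))

    framesOf : Fin m → List (Vec Block k)
    framesOf i = concatMap (permutedFrames i) (permutations k)

    framedHands : List (Vec Block k)
    framedHands = concatMap framesOf (allFin m)

    framesOf-sound : ∀ i {bs} → bs ∈ framesOf i → ∃[ π ] FramesHand bs (cards (permuteHand (hand i) π))
    framesOf-sound i bs∈ with ∈-concatMap⁻′ (permutedFrames i) (permutations k) bs∈
    ... | π , _ , bs∈′ = π , sound (frames-enumerates k _) bs∈′

    framesOf-same-hand : ∀ {i i′ bs} → bs ∈ framesOf i → bs ∈ framesOf i′ → i ≡ i′
    framesOf-same-hand {i} {i′} {bs} bs∈ bs∈′ with framesOf-sound i bs∈ | framesOf-sound i′ bs∈′
    -- Position j of the frame holds card π j of one representative and card π′ j of the other, so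
    -- the inverse of π followed by π′ matches the two hands.
    ... | π , fr | π′ , fr′ = distinct-hands i i′ (Perm.flip π Perm.∘ₚ π′ , λ j →
      subst (λ l → cards (hand i) l ≈C cards (hand i′) (π′ ⟨$⟩ʳ (π ⟨$⟩ˡ j))) (Perm.inverseʳ π)
        (frame-≈C {lookup bs (π ⟨$⟩ˡ j)} {cards (hand i) (π ⟨$⟩ʳ (π ⟨$⟩ˡ j))} {cards (hand i′) (π′ ⟨$⟩ʳ (π ⟨$⟩ˡ j))}
          (fr (π ⟨$⟩ˡ j)) (fr′ (π ⟨$⟩ˡ j))))

    -- At each position the frame determines the label space, and within one hand the label space
    -- determines the index of the card.
    permutedFrames-same-permutation : ∀ i {π π′ bs} → bs ∈ permutedFrames i π → bs ∈ permutedFrames i π′ → π Perm.≈ π′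
    permutedFrames-same-permutation i {π} {π′} {bs} bs∈ bs∈′ j = spaces-distinct (hand i) (π ⟨$⟩ʳ j) (π′ ⟨$⟩ʳ j)
      (proj₁ (frame-≈C {lookup bs j} {cards (hand i) (π ⟨$⟩ʳ j)} {cards (hand i) (π′ ⟨$⟩ʳ j)}
        (sound (frames-enumerates k (cards (permuteHand (hand i) π))) bs∈ j)
        (sound (frames-enumerates k (cards (permuteHand (hand i) π′))) bs∈′ j)))

    framedHands-enumerates : framedHands Enumerates Good
    framedHands-enumerates = record
      { unique = unique-concatMap framesOf (Uniqueₚ.allFin⁺ m)
          (λ {i} _ → allPairs-concatMap (permutedFrames i) (permutations-distinct k)
            (λ {π} _ → unique (frames-enumerates k (cards (permuteHand (hand i) π))))
            λ { {π} {π′} π≉π′ bs∈ bs∈′ refl → π≉π′ (permutedFrames-same-permutation i {π} {π′} bs∈ bs∈′) })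
          framesOf-same-hand
      ; sound = λ bs∈ → sound′ bs∈
      ; complete = λ {bs} good → complete′ bs good }
      where
      sound′ : ∀ {bs} → bs ∈ framedHands → Good bs
      sound′ {bs} bs∈ with ∈-concatMap⁻′ framesOf (allFin m) bs∈
      ... | i , _ , bs∈′ with framesOf-sound i bs∈′
      ...   | π , fr = framed⇒good (permuteHand (hand i) π) bs fr
      complete′ : ∀ bs → Good bs → bs ∈ framedHands
      complete′ bs good with good⇒framed bs good
      ... | H , fr with all-hands H
      -- The matching permutation π need not itself be in `permutations k`; a pointwise equal ρ is,
      -- and it selects the same cards.
      ...   | i , π , H≈ with permutations-complete k π
      ...     | ρ , ρ∈ , ρ≈π = ∈-concatMap⁺′ framesOf (∈-allFin i) (∈-concatMap⁺′ (permutedFrames i) ρ∈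
        (complete (frames-enumerates k (cards (permuteHand (hand i) ρ))) λ j →
          frames-resp {lookup bs j} {cards H j} {cards (hand i) (ρ ⟨$⟩ʳ j)}
            (subst (λ l → cards H j ≈C cards (hand i) l) (sym (ρ≈π j)) (H≈ j)) (fr j)))

    framedHands-weight : sumOver (weight 𝔽) framedHands ≡ (m // 1) *ℚ ((k !) // 1)
    framedHands-weight = begin
      sumOver (weight 𝔽) framedHands
        ≡⟨ sumOver-concatMap (weight 𝔽) framesOf (allFin m) ⟩
      sumOver (λ i → sumOver (weight 𝔽) (framesOf i)) (allFin m)
        ≡⟨ sumOver-cong (allFin m) (λ {i} _ → perHand i) ⟩
      sumOver (λ _ → (k !) // 1) (allFin m)
        ≡⟨ sumOver-const ((k !) // 1) (allFin m) ⟩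
      (length (allFin m) // 1) *ℚ ((k !) // 1)
        ≡⟨ cong (λ l → (l // 1) *ℚ ((k !) // 1)) (Listₚ.length-tabulate {n = m} id) ⟩
      (m // 1) *ℚ ((k !) // 1) ∎
      where
      open ≡-Reasoning
      perHand : ∀ i → sumOver (weight 𝔽) (framesOf i) ≡ (k !) // 1
      perHand i = begin
        sumOver (weight 𝔽) (framesOf i)
          ≡⟨ sumOver-concatMap (weight 𝔽) (permutedFrames i) (permutations k) ⟩
        sumOver (λ π → sumOver (weight 𝔽) (permutedFrames i π)) (permutations k)
          ≡⟨ sumOver-cong (permutations k) (λ {π} _ → frames-weight k (cards (permuteHand (hand i) π))) ⟩
        sumOver (λ _ → 1ℚ) (permutations k)
          ≡⟨ sumOver-const 1ℚ (permutations k) ⟩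
        (length (permutations k) // 1) *ℚ 1ℚ
          ≡⟨ ℚₚ.*-identityʳ (length (permutations k) // 1) ⟩
        length (permutations k) // 1
          ≡⟨ cong (_// 1) (permutations-length k) ⟩
        (k !) // 1 ∎

    -- Both lists enumerate `Good`, so their total weights agree: k! for each hand on the left, one
    -- coefficient of the k-th power for each basis of E_n on the right.
    orderedHands-count : (m // 1) *ℚ ((k !) // 1) ≡ (γ q n // 1) *ℚ powS (Enumerators.yDeckEnum 𝔽 𝓕) k n k
    orderedHands-count = ≡-trans (sym framedHands-weight)
      (≡-trans (sumOver-↭ (weight 𝔽) (enumerations-↭ framedHands-enumerates (goodList-enumerates k)))
        (goodList-weight k))

-- Division by k! and γ_n

divide : ∀ m a b x → a ≢ 0 → b ≢ 0 → (m // 1) *ℚ (a // 1) ≡ (b // 1) *ℚ x → m // b ≡ (1 // a) *ℚ x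
divide m a b x a≢0 b≢0 eq = begin
  m // b                       ≡⟨ //-as-product m b ⟩
  m/1 *ℚ 1/b                   ≡⟨ cong (_*ℚ 1/b) (ℚₚ.*-identityʳ m/1) ⟨
  (m/1 *ℚ 1ℚ) *ℚ 1/b           ≡⟨ cong (λ t → (m/1 *ℚ t) *ℚ 1/b) (//1-*-1// a a≢0) ⟨
  (m/1 *ℚ (a/1 *ℚ 1/a)) *ℚ 1/b ≡⟨ cong (_*ℚ 1/b) (ℚₚ.*-assoc m/1 a/1 1/a) ⟨
  ((m/1 *ℚ a/1) *ℚ 1/a) *ℚ 1/b ≡⟨ cong (λ t → (t *ℚ 1/a) *ℚ 1/b) eq ⟩
  ((b/1 *ℚ x) *ℚ 1/a) *ℚ 1/b   ≡⟨ cong (_*ℚ 1/b) (ℚₚ.*-comm (b/1 *ℚ x) 1/a) ⟩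
  (1/a *ℚ (b/1 *ℚ x)) *ℚ 1/b   ≡⟨ ℚₚ.*-assoc 1/a (b/1 *ℚ x) 1/b ⟩
  1/a *ℚ ((b/1 *ℚ x) *ℚ 1/b)   ≡⟨ cong (λ t → 1/a *ℚ (t *ℚ 1/b)) (ℚₚ.*-comm b/1 x) ⟩
  1/a *ℚ ((x *ℚ b/1) *ℚ 1/b)   ≡⟨ cong (1/a *ℚ_) (ℚₚ.*-assoc x b/1 1/b) ⟩
  1/a *ℚ (x *ℚ (b/1 *ℚ 1/b))   ≡⟨ cong (λ t → 1/a *ℚ (x *ℚ t)) (//1-*-1// b b≢0) ⟩
  1/a *ℚ (x *ℚ 1ℚ)             ≡⟨ cong (1/a *ℚ_) (ℚₚ.*-identityʳ x) ⟩
  1/a *ℚ x                     ∎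
  where
  open ≡-Reasoning
  m/1 = m // 1
  a/1 = a // 1
  b/1 = b // 1
  1/a = 1 // a
  1/b = 1 // b

mainTheorem2 : (𝔽 : FiniteField) (P : Set) (𝓕 : QExpFamily P)
    → (h : ℕ → ℕ → ℕ)
    → (∀ n k → HasCount (Hands.Hand 𝔽 𝓕 n k) (Hands._≈H_ 𝔽 𝓕) (h n k))
    → ∀ n k → Enumerators.handEnum 𝔽 𝓕 h n k ≡ expS (Enumerators.yDeckEnum 𝔽 𝓕) n k
mainTheorem2 𝔽 P 𝓕 h counts n k = ≡-trans
  (divide (h n k) (k !) (γ (FiniteField.q 𝔽) n) _ (ℕ.≢-nonZero⁻¹ (k !) {{ k ℕₚ.!≢0 }}) (LinearAlgebra.γ-nonzero 𝔽 n)
    (Framing.orderedHands-count 𝔽 𝓕 n (counts n k)))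
  (sym (expS-diagonal (Enumerators.yDeckEnum 𝔽 𝓕) (Blocks.yDeckEnum-linear {Vec (FiniteField.F 𝔽) n} 𝓕 𝔽) n k))
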